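{- Let $n$ be an odd positive integer. Then $$2160\sum_{m=1}^{n-1}\left[\sigma_3^{\dagger}(m)\sigma_7^{\dagger}(n-m)-\sigma_5^{\dagger}(m)\sigma_5^{\dagger}(n-m)\right]+186480\sum_{m=1}^{n-1}\left[\sigma_3(m)\sigma_7(n-m)-\sigma_5(m)\sigma_5(n-m)\right]$$ $$=759\,\sigma_3(n)-200\,\sigma_5(n)-642\,\sigma_7(n)+83\,\sigma_{11}(n).$$
   Context: For positive integers $r,n$, $\sigma_r(n):=\sum_{d\mid n,\,d>0}d^r$ and $\sigma_r^{\dagger}(n):=\sum_{d\mid n,\,d>0}(-1)^{d}d^r$. -}

module Defs where

open import Data.Integer using (ℤ; +_; 0ℤ; -1ℤ; _+_; _*_; _^_)
open import Data.List using (List; foldr; map; filter; upTo)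
open import Data.Nat using (ℕ; suc)
open import Data.Nat.Divisibility using (_∣?_)

-- upTo k = 0 , … , k − 1, so this is 1 , … , k.
1⋯_ : ℕ → List ℕ
1⋯ k = map suc (upTo k)

∑ : List ℕ → (ℕ → ℤ) → ℤ
∑ xs f = foldr _+_ 0ℤ (map f xs)

infix 5 ∑
syntax ∑ xs (λ x → e) = ∑[ x ∈ xs ] e

-- Positive divisors, each once; meaningful only for n > 0 (divisors 0 = []).
divisors : ℕ → List ℕ
divisors n = filter (_∣? n) (1⋯ n)

σ : ℕ → ℕ → ℤ
σ r n = ∑[ d ∈ divisors n ] ((+ d) ^ r)

σ† : ℕ → ℕ → ℤ
σ† r n = ∑[ d ∈ divisors n ] (-1ℤ ^ d * (+ d) ^ r)

{-# OPTIONS --safe #-}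

-- Since the divisor sums are over m = a x and n - m = b y, the left-hand side is a sum of
-- t(a, b) = (24 (-1)^(a+b) + 2072) (a³b⁷ - a⁵b⁵), up to the factor 90, over the positive quadruples
-- with a x + b y = n.  On such quadruples (a, b, x, y) ↦ (a - b, b, x, x + y) is a bijection from
-- {a > b} onto {x < y}.  Hence, for a weight k invariant under exchanging (a, x) and (b, y), the sum
-- of a weight T with T(a, b, x, y) = k(a, b, x, y) - k(a - b, b, x, x + y) for a ≥ b, where k
-- vanishes for a = 0, collapses to the boundary x = y, that is, to a sum over the divisors of n.
-- Here k may depend on the parities of
-- a, b, x, y; as n is odd there are six parity classes, permuted by the bijection.  Solving a linear
-- system gives a k whose T is the symmetrized t, up to a term with sum zero because
-- (a, x) ↦ (a / 2, 2 x) preserves a x.  The remaining sum over a + b = d is evaluated by telescoping.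

module Submission where

open import Defs
open import Data.Bool using (if_then_else_)
open import Data.Empty using (⊥-elim)
open import Data.Fin using (zero; suc)
open import Data.Integer using (ℤ; +_; 0ℤ; 1ℤ; -1ℤ; -_; _+_; _-_; _*_; _^_)
open import Data.Integer.Properties
open import Data.Integer.Tactic.RingSolver using (ring; solve-∀)
open import Data.List using (List; []; _∷_; length; filter; foldr; map)
open import Data.List.Properties using (map-∘; map-upTo)
open import Data.Nat as ℕ using (ℕ; zero; suc; _∸_; _≤_; _<_; z≤n; s≤s; _≡ᵇ_; parity; NonZero)
open import Data.Nat.Divisibility using (_∣_; _∤_; _∣?_; divides; ∣⇒≤)
import Data.Nat.Properties as ℕₚ
import Data.Nat.Tactic.RingSolver as ℕ-Solver
open import Data.Parity.Base as ℙ using (Parity; 0ℙ; 1ℙ)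
import Data.Parity.Properties as ℙₚ
open import Data.Vec using (Vec; []; _∷_)
open import Function using (_∘_)
open import Relation.Binary.Definitions using (tri<; tri≈; tri>)
open import Relation.Binary.PropositionalEquality hiding ([_])
open import Relation.Nullary using (¬_; yes; no)
open import Relation.Unary using (Pred; Decidable)
open import Tactic.RingSolver.NonReflective ring using (Expr; Κ; Ι; _⊕_; _⊗_; _⊛_; ⊝_; module Ops)
open import Tactic.RingSolver.Core.Polynomial.Semantics Ops.homo using () renaming (⟦_⟧ to ⟦_⟧ₚ)

open ≡-Reasoning
open Ops using (⟦_⟧; norm; correct)

private variable
  f h : ℕ → ℤ

*-leftComm : ∀ i j k → i * (j * k) ≡ j * (i * k)
*-leftComm = solve-∀

i+i≡2*i : ∀ i → i + i ≡ + 2 * i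
i+i≡2*i = solve-∀

0ℙ≢1ℙ : 0ℙ ≢ 1ℙ
0ℙ≢1ℙ ()

-- Finite sums

∑-cong : ∀ xs → (∀ x → f x ≡ h x) → ∑ xs f ≡ ∑ xs h
∑-cong []       eq = refl
∑-cong (x ∷ xs) eq = cong₂ _+_ (eq x) (∑-cong xs eq)

∑-zero : ∀ xs → ∑ xs (λ _ → 0ℤ) ≡ 0ℤ
∑-zero []       = refl
∑-zero (x ∷ xs) = trans (+-identityˡ _) (∑-zero xs)

∑-+ : ∀ xs (f h : ℕ → ℤ) → ∑[ x ∈ xs ] (f x + h x) ≡ ∑ xs f + ∑ xs h
∑-+ []       f h = refl
∑-+ (x ∷ xs) f h = trans (cong (_+_ (f x + h x)) (∑-+ xs f h)) (interchange (f x) (h x) _ _)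
  where
  interchange : ∀ i j k l → (i + j) + (k + l) ≡ (i + k) + (j + l)
  interchange = solve-∀

∑-*ˡ : ∀ xs c (f : ℕ → ℤ) → ∑[ x ∈ xs ] (c * f x) ≡ c * ∑ xs f
∑-*ˡ []       c f = sym (*-zeroʳ c)
∑-*ˡ (x ∷ xs) c f = trans (cong (_+_ (c * f x)) (∑-*ˡ xs c f)) (sym (*-distribˡ-+ c (f x) _))

∑-minus : ∀ xs (f h : ℕ → ℤ) → ∑[ x ∈ xs ] (f x - h x) ≡ ∑ xs f - ∑ xs h
∑-minus xs f h = begin
  ∑[ x ∈ xs ] (f x - h x)             ≡⟨ ∑-cong xs (λ x → cong (_+_ (f x)) (sym (-1*i≡-i (h x)))) ⟩
  ∑[ x ∈ xs ] (f x + -1ℤ * h x)       ≡⟨ ∑-+ xs f (λ x → -1ℤ * h x) ⟩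
  ∑ xs f + ∑ xs (λ x → -1ℤ * h x)     ≡⟨ cong (_+_ (∑ xs f)) (trans (∑-*ˡ xs -1ℤ h) (-1*i≡-i (∑ xs h))) ⟩
  ∑ xs f - ∑ xs h                     ∎

∑-*ʳ : ∀ xs (f : ℕ → ℤ) c → ∑[ x ∈ xs ] (f x * c) ≡ ∑ xs f * c
∑-*ʳ xs f c = trans (∑-cong xs (λ x → *-comm (f x) c)) (trans (∑-*ˡ xs c f) (*-comm c _))

∑-comm : ∀ xs ys (F : ℕ → ℕ → ℤ) → ∑[ x ∈ xs ] ∑[ y ∈ ys ] F x y ≡ ∑[ y ∈ ys ] ∑[ x ∈ xs ] F x y
∑-comm []       ys F = sym (∑-zero ys)
∑-comm (x ∷ xs) ys F = trans (cong (_+_ (∑ ys (F x))) (∑-comm xs ys F)) (sym (∑-+ ys (F x) _))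

∑-suc : ∀ n (f : ℕ → ℤ) → ∑ (1⋯ suc n) f ≡ f 1 + ∑ (1⋯ n) (f ∘ suc)
∑-suc n f = cong (λ xs → f 1 + foldr _+_ 0ℤ xs)
  (trans (cong (map f ∘ map suc) (sym (map-upTo suc n))) (sym (map-∘ (1⋯ n))))

∑-cong-range : ∀ n → (∀ a → 1 ≤ a → a ≤ n → f a ≡ h a) → ∑ (1⋯ n) f ≡ ∑ (1⋯ n) h
∑-cong-range zero    eq = refl
∑-cong-range {f} {h} (suc n) eq = begin
  ∑ (1⋯ suc n) f             ≡⟨ ∑-suc n f ⟩
  f 1 + ∑ (1⋯ n) (f ∘ suc)   ≡⟨ cong₂ _+_ (eq 1 (s≤s z≤n) (s≤s z≤n))
                                  (∑-cong-range n (λ a _ a≤n → eq (suc a) (s≤s z≤n) (s≤s a≤n))) ⟩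
  h 1 + ∑ (1⋯ n) (h ∘ suc)   ≡⟨ ∑-suc n h ⟨
  ∑ (1⋯ suc n) h             ∎

∑-zero-range : ∀ n → (∀ a → 1 ≤ a → a ≤ n → f a ≡ 0ℤ) → ∑ (1⋯ n) f ≡ 0ℤ
∑-zero-range n eq = trans (∑-cong-range n eq) (∑-zero (1⋯ n))

∑-extend : ∀ {m n} → m ≤ n → (∀ a → m < a → f a ≡ 0ℤ) → ∑ (1⋯ m) f ≡ ∑ (1⋯ n) f
∑-extend {n = n} z≤n vanish = sym (∑-zero-range n (λ a 1≤a _ → vanish a 1≤a))
∑-extend {f} {suc m} {suc n} (s≤s m≤n) vanish = begin
  ∑ (1⋯ suc m) f             ≡⟨ ∑-suc m f ⟩
  f 1 + ∑ (1⋯ m) (f ∘ suc)   ≡⟨ cong (_+_ (f 1)) (∑-extend m≤n (λ a m<a → vanish (suc a) (s≤s m<a))) ⟩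
  f 1 + ∑ (1⋯ n) (f ∘ suc)   ≡⟨ ∑-suc n f ⟨
  ∑ (1⋯ suc n) f             ∎

∑-telescope : ∀ n (f : ℕ → ℤ) → ∑[ i ∈ 1⋯ n ] (f (suc i) - f i) ≡ f (suc n) - f 1
∑-telescope zero    f = sym (+-inverseʳ (f 1))
∑-telescope (suc n) f = begin
  ∑[ i ∈ 1⋯ suc n ] (f (suc i) - f i)        ≡⟨ ∑-suc n (λ i → f (suc i) - f i) ⟩
  f 2 - f 1 + (∑[ i ∈ 1⋯ n ] (f (suc (suc i)) - f (suc i)))
                                             ≡⟨ cong (_+_ (f 2 - f 1)) (∑-telescope n (f ∘ suc)) ⟩
  f 2 - f 1 + (f (suc (suc n)) - f 2)        ≡⟨ cancel (f 1) (f 2) (f (suc (suc n))) ⟩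
  f (suc (suc n)) - f 1                      ∎
  where
  cancel : ∀ i j k → j - i + (k - j) ≡ k - i
  cancel = solve-∀

-- The Kronecker delta and reindexing of sums

-- Abstract, so that the arguments of δ can be inferred.
abstract

  δ : ℕ → ℕ → ℤ
  δ u v = if u ≡ᵇ v then 1ℤ else 0ℤ

  δ-refl : ∀ u → δ u u ≡ 1ℤ
  δ-refl zero    = refl
  δ-refl (suc u) = δ-refl u

  δ-≢ : ∀ {u v} → u ≢ v → δ u v ≡ 0ℤ
  δ-≢ {zero}  {zero}  u≢v = ⊥-elim (u≢v refl)
  δ-≢ {zero}  {suc v} u≢v = refl
  δ-≢ {suc u} {zero}  u≢v = refl
  δ-≢ {suc u} {suc v} u≢v = δ-≢ (u≢v ∘ cong suc)

  -- If `u` lies beyond `n`, no term survives and `vanish` makes the right-hand side zero too. So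
  -- the lemma also serves for indices such as `b + c` or `2 * i`, which may leave the range.
  δ-∑ : ∀ n u (f : ℕ → ℤ) → 1 ≤ u → (n < u → f u ≡ 0ℤ) → ∑[ a ∈ 1⋯ n ] (δ u a * f a) ≡ f u
  δ-∑ zero    u f 1≤u vanish = sym (vanish 1≤u)
  δ-∑ (suc n) (suc zero) f 1≤u vanish = begin
    ∑[ a ∈ 1⋯ suc n ] (δ 1 a * f a)                    ≡⟨ ∑-suc n (λ a → δ 1 a * f a) ⟩
    1ℤ * f 1 + (∑[ a ∈ 1⋯ n ] (δ 0 a * f (suc a)))     ≡⟨ cong₂ _+_ (*-identityˡ (f 1)) (∑-zero-range n zeros) ⟩
    f 1 + 0ℤ                                           ≡⟨ +-identityʳ (f 1) ⟩
    f 1                                                ∎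
    where
    zeros : ∀ a → 1 ≤ a → a ≤ n → δ 0 a * f (suc a) ≡ 0ℤ
    zeros (suc a) _ _ = refl
  δ-∑ (suc n) (suc (suc u)) f 1≤u vanish = begin
    ∑[ a ∈ 1⋯ suc n ] (δ (suc (suc u)) a * f a)                 ≡⟨ ∑-suc n (λ a → δ (suc (suc u)) a * f a) ⟩
    0ℤ * f 1 + (∑[ a ∈ 1⋯ n ] (δ (suc u) a * f (suc a)))        ≡⟨ +-identityˡ _ ⟩
    ∑[ a ∈ 1⋯ n ] (δ (suc u) a * f (suc a))                     ≡⟨ δ-∑ n (suc u) (f ∘ suc) (s≤s z≤n) (vanish ∘ s≤s) ⟩
    f (suc (suc u))                                             ∎

δ-≡ : ∀ {u v} → u ≡ v → δ u v ≡ 1ℤ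
δ-≡ {u} refl = δ-refl u

δ-⇔ : ∀ {u v u′ v′} → (u ≡ v → u′ ≡ v′) → (u′ ≡ v′ → u ≡ v) → δ u v ≡ δ u′ v′
δ-⇔ {u} {v} to from with u ℕ.≟ v
... | yes u≡v = trans (δ-≡ u≡v) (sym (δ-≡ (to u≡v)))
... | no  u≢v = trans (δ-≢ u≢v) (sym (δ-≢ (u≢v ∘ from)))

-- Makes the constraint encoded by `δ`, such as a x + b y = n, available when rewriting the other
-- factor.
δ-guard : ∀ {u v i j} → (u ≡ v → i ≡ j) → δ u v * i ≡ δ u v * j
δ-guard {u} {v} {i} {j} eq with u ℕ.≟ v
... | yes u≡v = cong (δ u v *_) (eq u≡v)
... | no  u≢v = trans (cong (_* i) (δ-≢ u≢v)) (cong (_* j) (sym (δ-≢ u≢v)))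

δ-∑-1 : ∀ n u → 1 ≤ u → u ≤ n → ∑[ a ∈ 1⋯ n ] δ u a ≡ 1ℤ
δ-∑-1 n u 1≤u u≤n = trans (∑-cong (1⋯ n) (λ a → sym (*-identityʳ (δ u a))))
  (δ-∑ n u (λ _ → 1ℤ) 1≤u (λ n<u → ⊥-elim (ℕₚ.<⇒≱ n<u u≤n)))

-- Reindexing along u: the inner sum counts the preimages of a.
∑-reindex : ∀ m n (u : ℕ → ℕ) (f : ℕ → ℤ) → (∀ i → 1 ≤ i → 1 ≤ u i) → (∀ a → n < a → f a ≡ 0ℤ) →
  ∑[ i ∈ 1⋯ m ] f (u i) ≡ ∑[ a ∈ 1⋯ n ] ((∑[ i ∈ 1⋯ m ] δ (u i) a) * f a)
∑-reindex m n u f pos vanish = begin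
  ∑[ i ∈ 1⋯ m ] f (u i)                            ≡⟨ ∑-cong-range m (λ i 1≤i _ → sym (δ-∑ n (u i) f (pos i 1≤i) (vanish (u i)))) ⟩
  ∑[ i ∈ 1⋯ m ] ∑[ a ∈ 1⋯ n ] (δ (u i) a * f a)    ≡⟨ ∑-comm (1⋯ m) (1⋯ n) _ ⟩
  ∑[ a ∈ 1⋯ n ] ∑[ i ∈ 1⋯ m ] (δ (u i) a * f a)    ≡⟨ ∑-cong (1⋯ n) (λ a → ∑-*ʳ (1⋯ m) (λ i → δ (u i) a) (f a)) ⟩
  ∑[ a ∈ 1⋯ n ] ((∑[ i ∈ 1⋯ m ] δ (u i) a) * f a)  ∎

∑-filter : ∀ {p} {Q : Pred ℕ p} (Q? : Decidable Q) xs (χ : ℕ → ℤ) →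
  (∀ x → Q x → χ x ≡ 1ℤ) → (∀ x → ¬ Q x → χ x ≡ 0ℤ) → ∑ (filter Q? xs) f ≡ ∑[ x ∈ xs ] (χ x * f x)
∑-filter Q? [] χ one zer = refl
∑-filter {f} Q? (x ∷ xs) χ one zer with Q? x
... | yes Qx = cong₂ _+_ (sym (trans (cong (_* f x) (one x Qx)) (*-identityˡ (f x)))) (∑-filter Q? xs χ one zer)
... | no ¬Qx = trans (∑-filter Q? xs χ one zer)
  (sym (trans (cong (λ i → i * f x + ∑ xs (λ x → χ x * f x)) (zer x ¬Qx)) (+-identityˡ _)))

-- Parity

sgn : Parity → ℤ
sgn 0ℙ = 1ℤ
sgn 1ℙ = -1ℤ

even : Parity → ℤ
even 0ℙ = 1ℤ
even 1ℙ = 0ℤ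

data Half : ℕ → Set where
  twice  : ∀ k → Half (2 ℕ.* k)
  twice+ : ∀ k → Half (suc (2 ℕ.* k))

halve : ∀ n → Half n
halve zero = twice 0
halve (suc n) with halve n
... | twice k  = twice+ k
... | twice+ k = subst Half (cong suc (ℕₚ.+-suc k (k ℕ.+ 0))) (twice (suc k))

parity-2* : ∀ k → parity (2 ℕ.* k) ≡ 0ℙ
parity-2* k = ℙₚ.*-homo-* 2 k

parity-1+2* : ∀ k → parity (suc (2 ℕ.* k)) ≡ 1ℙ
parity-1+2* k = trans (ℙₚ.+-homo-+ 1 (2 ℕ.* k)) (cong (1ℙ ℙ.+_) (parity-2* k))

parity-*-+ : ∀ a b x y → parity (a ℕ.* x ℕ.+ b ℕ.* y) ≡ (parity a ℙ.* parity x) ℙ.+ (parity b ℙ.* parity y)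
parity-*-+ a b x y = trans (ℙₚ.+-homo-+ (a ℕ.* x) (b ℕ.* y)) (cong₂ ℙ._+_ (ℙₚ.*-homo-* a x) (ℙₚ.*-homo-* b y))

parity-odd : ∀ {n} → 2 ∤ n → parity n ≡ 1ℙ
parity-odd {n} 2∤n with halve n
... | twice k  = ⊥-elim (2∤n (divides k (ℕₚ.*-comm 2 k)))
... | twice+ k = parity-1+2* k

sgn-parity : ∀ a → -1ℤ ^ a ≡ sgn (parity a)
sgn-parity zero          = refl
sgn-parity (suc zero)    = refl
sgn-parity (suc (suc a)) = trans (square (-1ℤ ^ a)) (sgn-parity a)
  where
  square : ∀ i → -1ℤ * (-1ℤ * i) ≡ i
  square = solve-∀

-- Weighted sums over the quadruples with a x + b y = n

∑₂ : ℕ → (ℕ → ℕ → ℤ) → ℤ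
∑₂ n G = ∑[ a ∈ 1⋯ n ] ∑[ b ∈ 1⋯ n ] G a b

∑₂-cong : ∀ n {G G′ : ℕ → ℕ → ℤ} → (∀ a b → G a b ≡ G′ a b) → ∑₂ n G ≡ ∑₂ n G′
∑₂-cong n eq = ∑-cong (1⋯ n) (λ a → ∑-cong (1⋯ n) (eq a))

∑₂-cong-range : ∀ n {G G′ : ℕ → ℕ → ℤ} → (∀ a b → 1 ≤ a → 1 ≤ b → G a b ≡ G′ a b) → ∑₂ n G ≡ ∑₂ n G′
∑₂-cong-range n eq = ∑-cong-range n (λ a 1≤a _ → ∑-cong-range n (λ b 1≤b _ → eq a b 1≤a 1≤b))

∑₂-zero-range : ∀ n {G : ℕ → ℕ → ℤ} → (∀ a b → 1 ≤ a → 1 ≤ b → G a b ≡ 0ℤ) → ∑₂ n G ≡ 0ℤ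
∑₂-zero-range n eq = ∑-zero-range n (λ a 1≤a _ → ∑-zero-range n (λ b 1≤b _ → eq a b 1≤a 1≤b))

∑₂-+ : ∀ n (G G′ : ℕ → ℕ → ℤ) → ∑₂ n (λ a b → G a b + G′ a b) ≡ ∑₂ n G + ∑₂ n G′
∑₂-+ n G G′ = trans (∑-cong (1⋯ n) (λ a → ∑-+ (1⋯ n) (G a) (G′ a))) (∑-+ (1⋯ n) _ _)

∑₂-*ˡ : ∀ n c (G : ℕ → ℕ → ℤ) → ∑₂ n (λ a b → c * G a b) ≡ c * ∑₂ n G
∑₂-*ˡ n c G = trans (∑-cong (1⋯ n) (λ a → ∑-*ˡ (1⋯ n) c (G a))) (∑-*ˡ (1⋯ n) c _)

∑₂-comm : ∀ n (G : ℕ → ℕ → ℤ) → ∑₂ n G ≡ ∑₂ n (λ a b → G b a)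
∑₂-comm n G = ∑-comm (1⋯ n) (1⋯ n) G

∑-∑₂-comm : ∀ xs n (G : ℕ → ℕ → ℕ → ℤ) → ∑[ m ∈ xs ] ∑₂ n (G m) ≡ ∑₂ n (λ a b → ∑[ m ∈ xs ] G m a b)
∑-∑₂-comm xs n G = trans (∑-comm xs (1⋯ n) _) (∑-cong (1⋯ n) (λ a → ∑-comm xs (1⋯ n) (λ m → G m a)))

∑₂-∑₂-comm : ∀ n (G : ℕ → ℕ → ℕ → ℕ → ℤ) →
  ∑₂ n (λ a b → ∑₂ n (G a b)) ≡ ∑₂ n (λ x y → ∑₂ n (λ a b → G a b x y))
∑₂-∑₂-comm n G = trans (∑-cong (1⋯ n) (λ a → ∑-∑₂-comm (1⋯ n) n (G a))) (∑-∑₂-comm (1⋯ n) n _)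

∑-*-∑ : ∀ xs ys (f h : ℕ → ℤ) → ∑ xs f * ∑ ys h ≡ ∑[ x ∈ xs ] ∑[ y ∈ ys ] (f x * h y)
∑-*-∑ xs ys f h = trans (sym (∑-*ʳ xs f (∑ ys h))) (∑-cong xs (λ x → sym (∑-*ˡ ys (f x) h)))

∑₂-*-∑₂ : ∀ n (G G′ : ℕ → ℕ → ℤ) →
  ∑₂ n G * ∑₂ n G′ ≡ ∑₂ n (λ a b → ∑₂ n (λ x y → G a x * G′ b y))
∑₂-*-∑₂ n G G′ = trans (∑-*-∑ (1⋯ n) (1⋯ n) _ _)
  (∑₂-cong n (λ a b → ∑-*-∑ (1⋯ n) (1⋯ n) (G a) (G′ b)))

-- The sum counts the `c ≥ 1` with `u + c = v`. It is the indicator of `u < v` in the form that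
-- `∑-reindex` produces.
∑-δ-< : ∀ n {u v} → u < v → v ≤ n → ∑[ c ∈ 1⋯ n ] δ (u ℕ.+ c) v ≡ 1ℤ
∑-δ-< n {u} {v} u<v v≤n = trans
  (∑-cong (1⋯ n) (λ c → δ-⇔ (λ { refl → ℕₚ.m+n∸m≡n u c }) (λ { refl → ℕₚ.m+[n∸m]≡n (ℕₚ.<⇒≤ u<v) })))
  (δ-∑-1 n (v ∸ u) (ℕₚ.m<n⇒0<n∸m u<v) (ℕₚ.≤-trans (ℕₚ.m∸n≤m v u) v≤n))

∑-δ-≥ : ∀ n {u v} → v ≤ u → ∑[ c ∈ 1⋯ n ] δ (u ℕ.+ c) v ≡ 0ℤ
∑-δ-≥ n {u} v≤u = ∑-zero-range n
  (λ c 1≤c _ → δ-≢ (λ { refl → ℕₚ.<⇒≱ (ℕₚ.m<m+n u 1≤c) v≤u }))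

trichotomy : ∀ n a b → a ≤ n → b ≤ n →
  (∑[ c ∈ 1⋯ n ] δ (b ℕ.+ c) a) + (∑[ c ∈ 1⋯ n ] δ (a ℕ.+ c) b) + δ a b ≡ 1ℤ
trichotomy n a b a≤n b≤n with ℕₚ.<-cmp a b
... | tri< a<b a≢b _ = cong₂ _+_ (cong₂ _+_ (∑-δ-≥ n (ℕₚ.<⇒≤ a<b)) (∑-δ-< n a<b b≤n)) (δ-≢ a≢b)
... | tri≈ _ refl _  = cong₂ _+_ (cong₂ _+_ (∑-δ-≥ n {a} ℕₚ.≤-refl) (∑-δ-≥ n {a} ℕₚ.≤-refl)) (δ-refl a)
... | tri> _ a≢b b<a = cong₂ _+_ (cong₂ _+_ (∑-δ-< n b<a a≤n) (∑-δ-≥ n (ℕₚ.<⇒≤ b<a))) (δ-≢ a≢b)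

-- Weight each term by the three indicators of `trichotomy`, then reindex the two strict parts by
-- the difference `c`. The larger entry may then exceed `n`; the hypotheses make those terms zero.
∑₂-split : ∀ n (G : ℕ → ℕ → ℤ) → (∀ a b → n < a → G a b ≡ 0ℤ) → (∀ a b → n < b → G a b ≡ 0ℤ) →
  ∑₂ n G ≡ ∑₂ n (λ b c → G (b ℕ.+ c) b) + ∑₂ n (λ a c → G a (a ℕ.+ c)) + (∑[ a ∈ 1⋯ n ] G a a)
∑₂-split n G vanishˡ vanishʳ = begin
  ∑₂ n G
    ≡⟨ ∑-cong-range n (λ a _ a≤n → ∑-cong-range n (λ b _ b≤n →
         trans (sym (*-identityˡ (G a b))) (trans (cong (_* G a b) (sym (trichotomy n a b a≤n b≤n))) (expand (θ b a) (θ a b) (δ a b) (G a b))))) ⟩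
  ∑₂ n (λ a b → θ b a * G a b + θ a b * G a b + δ a b * G a b)
    ≡⟨ trans (∑₂-+ n (λ a b → θ b a * G a b + θ a b * G a b) (λ a b → δ a b * G a b))
         (cong (_+ ∑₂ n (λ a b → δ a b * G a b)) (∑₂-+ n (λ a b → θ b a * G a b) (λ a b → θ a b * G a b))) ⟩
  ∑₂ n (λ a b → θ b a * G a b) + ∑₂ n (λ a b → θ a b * G a b) + ∑₂ n (λ a b → δ a b * G a b)
    ≡⟨ cong₂ _+_ (cong₂ _+_ greater less) equal ⟩
  ∑₂ n (λ b c → G (b ℕ.+ c) b) + ∑₂ n (λ a c → G a (a ℕ.+ c)) + (∑[ a ∈ 1⋯ n ] G a a) ∎
  where
  θ : ℕ → ℕ → ℤ
  θ u v = ∑[ c ∈ 1⋯ n ] δ (u ℕ.+ c) v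
  expand : ∀ i j k l → (i + j + k) * l ≡ i * l + j * l + k * l
  expand = solve-∀
  pos : ∀ u c → 1 ≤ c → 1 ≤ u ℕ.+ c
  pos u c 1≤c = ℕₚ.≤-trans 1≤c (ℕₚ.m≤n+m c u)
  greater : ∑₂ n (λ a b → θ b a * G a b) ≡ ∑₂ n (λ b c → G (b ℕ.+ c) b)
  greater = trans (∑₂-comm n (λ a b → θ b a * G a b))
    (∑-cong (1⋯ n) (λ b → sym (∑-reindex n n (b ℕ.+_) (λ a → G a b) (pos b) (λ a → vanishˡ a b))))
  less : ∑₂ n (λ a b → θ a b * G a b) ≡ ∑₂ n (λ a c → G a (a ℕ.+ c))
  less = ∑-cong (1⋯ n) (λ a → sym (∑-reindex n n (a ℕ.+_) (G a) (pos a) (vanishʳ a)))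
  equal : ∑₂ n (λ a b → δ a b * G a b) ≡ ∑[ a ∈ 1⋯ n ] G a a
  equal = ∑-cong-range n (λ a 1≤a _ → δ-∑ n a (G a) 1≤a (vanishˡ a a))

-- Sums over quadruples and the Euclidean step

Weight : Set
Weight = ℕ → ℕ → ℕ → ℕ → ℤ

slice : ℕ → Weight → ℕ → ℕ → ℤ
slice n F a b = ∑₂ n (λ x y → δ (a ℕ.* x ℕ.+ b ℕ.* y) n * F a b x y)

-- The entries of a positive solution of a x + b y = n are at most `n`, so the ranges lose none.
L : ℕ → Weight → ℤ
L n F = ∑₂ n (slice n F)

L-cong : ∀ n {F F′} → (∀ a b x y → a ℕ.* x ℕ.+ b ℕ.* y ≡ n → F a b x y ≡ F′ a b x y) → L n F ≡ L n F′
L-cong n eq = ∑₂-cong n (λ a b → ∑₂-cong n (λ x y → δ-guard (eq a b x y)))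

L-+ : ∀ n (F F′ : Weight) → L n (λ a b x y → F a b x y + F′ a b x y) ≡ L n F + L n F′
L-+ n F F′ = trans (∑₂-cong n (λ a b → trans (∑₂-cong n (λ x y → *-distribˡ-+ (δ (a ℕ.* x ℕ.+ b ℕ.* y) n) _ _)) (∑₂-+ n _ _))) (∑₂-+ n _ _)

L-*ˡ : ∀ n c (F : Weight) → L n (λ a b x y → c * F a b x y) ≡ c * L n F
L-*ˡ n c F = trans (∑₂-cong n (λ a b → trans (∑₂-cong n (λ x y → *-leftComm (δ (a ℕ.* x ℕ.+ b ℕ.* y) n) c (F a b x y))) (∑₂-*ˡ n c _))) (∑₂-*ˡ n c _)

L-minus : ∀ n (F F′ : Weight) → L n (λ a b x y → F a b x y - F′ a b x y) ≡ L n F - L n F′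
L-minus n F F′ = begin
  L n (λ a b x y → F a b x y - F′ a b x y)          ≡⟨ L-cong n (λ a b x y _ → cong (_+_ (F a b x y)) (sym (-1*i≡-i (F′ a b x y)))) ⟩
  L n (λ a b x y → F a b x y + -1ℤ * F′ a b x y)    ≡⟨ L-+ n F (λ a b x y → -1ℤ * F′ a b x y) ⟩
  L n F + L n (λ a b x y → -1ℤ * F′ a b x y)        ≡⟨ cong (_+_ (L n F)) (trans (L-*ˡ n -1ℤ F′) (-1*i≡-i (L n F′))) ⟩
  L n F - L n F′                                    ∎

slice-swap : ∀ n F a b → slice n F a b ≡ slice n (λ a b x y → F b a y x) b a
slice-swap n F a b = trans (∑₂-comm n _)
  (∑₂-cong n (λ x y → cong (λ m → δ m n * F a b y x) (ℕₚ.+-comm (a ℕ.* y) (b ℕ.* x))))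

L-swap : ∀ n F → L n F ≡ L n (λ a b x y → F b a y x)
L-swap n F = trans (∑₂-comm n _) (∑₂-cong n (λ a b → slice-swap n F b a))

L-dual : ∀ n F → L n F ≡ L n (λ a b x y → F x y a b)
L-dual n F = trans (∑₂-∑₂-comm n _) (∑₂-cong n (λ x y → ∑₂-cong n (λ a b →
  cong (λ m → δ m n * F a b x y) (cong₂ ℕ._+_ (ℕₚ.*-comm a x) (ℕₚ.*-comm b y)))))

<-*-+ : ∀ {n a x} v → n < a → 1 ≤ x → n < a ℕ.* x ℕ.+ v
<-*-+ {a = a} {x} v n<a 1≤x = ℕₚ.<-≤-trans n<a
  (ℕₚ.≤-trans (ℕₚ.≤-reflexive (sym (ℕₚ.*-identityʳ a))) (ℕₚ.≤-trans (ℕₚ.*-monoʳ-≤ a 1≤x) (ℕₚ.m≤m+n (a ℕ.* x) v)))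

slice-vanish : ∀ n F a b → n < a → slice n F a b ≡ 0ℤ
slice-vanish n F a b n<a = ∑₂-zero-range n (λ x y 1≤x _ →
  cong (_* F a b x y) (δ-≢ (ℕₚ.>⇒≢ (<-*-+ (b ℕ.* y) n<a 1≤x))))

Symmetric : Weight → Set
Symmetric F = ∀ a b x y → F a b x y ≡ F b a y x

slice-symmetric : ∀ n F → Symmetric F → ∀ a b → slice n F a b ≡ slice n F b a
slice-symmetric n F F-sym a b = trans (slice-swap n F a b)
  (∑₂-cong n (λ x y → cong (δ (b ℕ.* x ℕ.+ a ℕ.* y) n *_) (sym (F-sym b a x y))))

above : ℕ → Weight → ℤ
above n F = ∑₂ n (λ b c → slice n F (b ℕ.+ c) b)

L-split : ∀ n F → Symmetric F → L n F ≡ + 2 * above n F + (∑[ a ∈ 1⋯ n ] slice n F a a)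
L-split n F F-sym = begin
  L n F
    ≡⟨ ∑₂-split n (slice n F) (slice-vanish n F)
         (λ a b n<b → trans (slice-symmetric n F F-sym a b) (slice-vanish n F b a n<b)) ⟩
  above n F + ∑₂ n (λ a c → slice n F a (a ℕ.+ c)) + diagonal
    ≡⟨ cong (λ i → above n F + i + diagonal) (∑₂-cong n (λ a c → slice-symmetric n F F-sym a (a ℕ.+ c))) ⟩
  above n F + above n F + diagonal
    ≡⟨ cong (_+ diagonal) (i+i≡2*i (above n F)) ⟩
  + 2 * above n F + diagonal ∎
  where
  diagonal : ℤ
  diagonal = ∑[ a ∈ 1⋯ n ] slice n F a a

-- Write k* for `k` with (a, b) and (x, y) exchanged. Summing `step` over a > b gives
-- `above n t + above n k* ≡ above n k`, because (a - b, b, x, x + y) runs through the quadruples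
-- with x < y. Since `L n k ≡ L n k*`, splitting both by `L-split` cancels the strict parts and
-- leaves the diagonal of k*, which is x = y for `k`. The diagonal of `t` is absorbed by `diag`.
L-euclid : ∀ n (k t : Weight) → Symmetric k → Symmetric t →
  (∀ b c x y → t (b ℕ.+ c) b x y + k c b x (x ℕ.+ y) ≡ k (b ℕ.+ c) b x y) →
  (∀ b x y → t b b x y ≡ k b b x y) →
  L n t ≡ ∑[ x ∈ 1⋯ n ] ∑₂ n (λ a b → δ (x ℕ.* a ℕ.+ x ℕ.* b) n * k a b x x)
L-euclid n k t k-sym t-sym step diag = begin
  L n t                                          ≡⟨ L-split n t t-sym ⟩
  + 2 * above n t + D t                          ≡⟨ rearrange (above n t) (above n k*) (D t) ⟩
  + 2 * (above n t + above n k*) + D t - + 2 * above n k*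
                                                 ≡⟨ cong₂ (λ i j → + 2 * i + j - + 2 * above n k*) above-k D-t ⟩
  + 2 * above n k + D k - + 2 * above n k*       ≡⟨ cong (_- + 2 * above n k*) (sym (L-split n k k-sym)) ⟩
  L n k - + 2 * above n k*                       ≡⟨ cong (_- + 2 * above n k*) (L-dual n k) ⟩
  L n k* - + 2 * above n k*                      ≡⟨ cong (_- + 2 * above n k*) (L-split n k* (λ a b x y → k-sym x y a b)) ⟩
  + 2 * above n k* + D k* - + 2 * above n k*     ≡⟨ cancel (+ 2 * above n k*) (D k*) ⟩
  D k*                                           ∎
  where
  k* : Weight
  k* a b x y = k x y a b
  D : Weight → ℤ
  D F = ∑[ a ∈ 1⋯ n ] slice n F a a
  rearrange : ∀ i j l → + 2 * i + l ≡ + 2 * (i + j) + l - + 2 * j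
  rearrange = solve-∀
  cancel : ∀ i j → i + j - i ≡ j
  cancel = solve-∀
  D-t : D t ≡ D k
  D-t = ∑-cong (1⋯ n) (λ a → ∑₂-cong n (λ x y → cong (δ (a ℕ.* x ℕ.+ a ℕ.* y) n *_) (diag a x y)))
  N : ℕ → ℕ → ℕ → ℕ → ℕ
  N b c x y = (b ℕ.+ c) ℕ.* x ℕ.+ b ℕ.* y
  -- Invariance of the constraint: the right-hand side belongs to the quadruple (x + y, x, b, c).
  N-sym : ∀ b c x y → (b ℕ.+ c) ℕ.* x ℕ.+ b ℕ.* y ≡ (x ℕ.+ y) ℕ.* b ℕ.+ x ℕ.* c
  N-sym = ℕ-Solver.solve-∀
  above-k* : above n k* ≡ ∑₂ n (λ b c → ∑₂ n (λ x y → δ (N b c x y) n * k c b x (x ℕ.+ y)))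
  above-k* = trans (∑₂-∑₂-comm n (λ b c x y → δ (N b c x y) n * k x y (b ℕ.+ c) b))
    (∑₂-cong n (λ b c → ∑₂-cong n (λ x y →
      cong₂ (λ m i → δ m n * i) (N-sym x y b c) (k-sym b c (x ℕ.+ y) x))))
  above-k : above n t + above n k* ≡ above n k
  above-k = trans (cong (_+_ (above n t)) above-k*) (trans (sym (∑₂-+ n _ _)) (∑₂-cong n (λ b c →
    trans (sym (∑₂-+ n _ _)) (∑₂-cong n (λ x y → trans (sym (*-distribˡ-+ (δ (N b c x y) n) _ _))
      (cong (δ (N b c x y) n *_) (step b c x y)))))))

-- Even entries and halving

∑-δ-2* : ∀ n a → 1 ≤ a → a ≤ n → ∑[ i ∈ 1⋯ n ] δ (2 ℕ.* i) a ≡ even (parity a)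
∑-δ-2* n a 1≤a a≤n with halve a
... | twice (suc k) = trans (∑-cong (1⋯ n) (λ i → δ-⇔ (λ eq → sym (ℕₚ.*-cancelˡ-≡ i (suc k) 2 eq)) (cong (2 ℕ.*_) ∘ sym)))
  (trans (δ-∑-1 n (suc k) (s≤s z≤n) (ℕₚ.≤-trans (ℕₚ.m≤m+n (suc k) _) a≤n)) (cong even (sym (parity-2* (suc k)))))
... | twice+ k = trans (∑-zero-range n (λ i _ _ → δ-≢ (λ eq → 0ℙ≢1ℙ (trans (sym (parity-2* i)) (trans (cong parity eq) (parity-1+2* k))))))
  (cong even (sym (parity-1+2* k)))

∑-even : ∀ n (f : ℕ → ℤ) → (∀ a → n < a → f a ≡ 0ℤ) → ∑[ a ∈ 1⋯ n ] (even (parity a) * f a) ≡ ∑[ a ∈ 1⋯ n ] f (2 ℕ.* a)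
∑-even n f vanish = trans (∑-cong-range n (λ a 1≤a a≤n → cong (_* f a) (sym (∑-δ-2* n a 1≤a a≤n))))
  (sym (∑-reindex n n (2 ℕ.*_) f (λ i 1≤i → ℕₚ.≤-trans 1≤i (ℕₚ.m≤m+n i _)) vanish))

-- Both sides equal the sum of `f (2 * a) b` over 2 a x + b y = n, the factor 2 being read as part
-- of the first entry or of its cofactor.
L-halve : ∀ n (f : ℕ → ℕ → ℤ) →
  L n (λ a b _ _ → even (parity a) * f a b) ≡ L n (λ a b x _ → even (parity x) * f (2 ℕ.* a) b)
L-halve n f = begin
  L n (λ a b _ _ → even (parity a) * f a b)
    ≡⟨ ∑₂-comm n _ ⟩
  ∑₂ n (λ b a → slice n (λ a b _ _ → even (parity a) * f a b) a b)
    ≡⟨ ∑-cong (1⋯ n) (λ b → trans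
         (∑-cong (1⋯ n) (λ a → trans (∑₂-cong n (λ x y → *-leftComm (δ (a ℕ.* x ℕ.+ b ℕ.* y) n) (even (parity a)) (f a b))) (∑₂-*ˡ n (even (parity a)) _)))
         (∑-even n (λ a → slice n (λ a b _ _ → f a b) a b) (λ a → slice-vanish n (λ a b _ _ → f a b) a b))) ⟩
  ∑₂ n (λ b a → slice n (λ a b _ _ → f a b) (2 ℕ.* a) b)
    ≡⟨ ∑₂-comm n _ ⟩
  ∑₂ n (λ a b → slice n (λ a b _ _ → f a b) (2 ℕ.* a) b)
    ≡⟨ ∑-cong-range n (λ a 1≤a _ → ∑-cong (1⋯ n) (λ b → right a b 1≤a)) ⟩
  L n (λ a b x _ → even (parity x) * f (2 ℕ.* a) b) ∎
  where
  assoc-comm : ∀ a x y → 2 ℕ.* a ℕ.* x ℕ.+ y ≡ a ℕ.* (2 ℕ.* x) ℕ.+ y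
  assoc-comm = ℕ-Solver.solve-∀
  right : ∀ a b → 1 ≤ a → slice n (λ a b _ _ → f a b) (2 ℕ.* a) b ≡ slice n (λ a b x _ → even (parity x) * f (2 ℕ.* a) b) a b
  right a b 1≤a = begin
    ∑₂ n (λ x y → δ (2 ℕ.* a ℕ.* x ℕ.+ b ℕ.* y) n * f (2 ℕ.* a) b)
      ≡⟨ ∑₂-cong n (λ x y → cong (λ m → δ m n * f (2 ℕ.* a) b) (assoc-comm a x (b ℕ.* y))) ⟩
    ∑[ x ∈ 1⋯ n ] row (2 ℕ.* x)
      ≡⟨ ∑-even n row (λ x n<x → ∑-zero-range n (λ y _ _ → cong (_* f (2 ℕ.* a) b) (δ-≢ (ℕₚ.>⇒≢
           (subst (λ m → n < m ℕ.+ b ℕ.* y) (ℕₚ.*-comm x a) (<-*-+ (b ℕ.* y) n<x 1≤a)))))) ⟨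
    ∑[ x ∈ 1⋯ n ] (even (parity x) * row x)
      ≡⟨ ∑-cong (1⋯ n) (λ x → trans (sym (∑-*ˡ (1⋯ n) (even (parity x)) _))
           (∑-cong (1⋯ n) (λ y → *-leftComm (even (parity x)) (δ (a ℕ.* x ℕ.+ b ℕ.* y) n) (f (2 ℕ.* a) b)))) ⟩
    ∑₂ n (λ x y → δ (a ℕ.* x ℕ.+ b ℕ.* y) n * (even (parity x) * f (2 ℕ.* a) b)) ∎
    where
    row : ℕ → ℤ
    row x = ∑[ y ∈ 1⋯ n ] (δ (a ℕ.* x ℕ.+ b ℕ.* y) n * f (2 ℕ.* a) b)

-- Divisor sums and their convolutions

-- A divisor `d` is recorded with its cofactor `x`; the number `χ d` of cofactors is 1 or 0. The
-- range `n` does not depend on `m`, so that sums for different `m` can be interchanged.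
∑-divisors : ∀ n m (φ : ℕ → ℤ) → 1 ≤ m → m ≤ n → ∑ (divisors m) φ ≡ ∑₂ n (λ d x → δ (d ℕ.* x) m * φ d)
∑-divisors n m φ 1≤m m≤n = begin
  ∑ (divisors m) φ               ≡⟨ ∑-filter (_∣? m) (1⋯ m) χ χ-∣ χ-∤ ⟩
  ∑[ d ∈ 1⋯ m ] (χ d * φ d)      ≡⟨ ∑-extend m≤n (λ d m<d → cong (_* φ d) (χ-∤ d (λ d∣m → ℕₚ.<⇒≱ m<d (∣⇒≤ ⦃ ℕ.>-nonZero 1≤m ⦄ d∣m)))) ⟩
  ∑[ d ∈ 1⋯ n ] (χ d * φ d)      ≡⟨ ∑-cong (1⋯ n) (λ d → sym (∑-*ʳ (1⋯ n) (λ x → δ (d ℕ.* x) m) (φ d))) ⟩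
  ∑₂ n (λ d x → δ (d ℕ.* x) m * φ d) ∎
  where
  χ : ℕ → ℤ
  χ d = ∑[ x ∈ 1⋯ n ] δ (d ℕ.* x) m
  χ-∣ : ∀ d → d ∣ m → χ d ≡ 1ℤ
  χ-∣ d (divides q eq) with ℕ.>-nonZero 1≤m
  ... | nz = trans (∑-cong (1⋯ n) (λ x → δ-⇔ {v′ = x} (to x) (λ { refl → sym (trans eq (ℕₚ.*-comm q d)) })))
      (δ-∑-1 n q (pos q eq) (ℕₚ.≤-trans (∣⇒≤ ⦃ nz ⦄ (divides d (trans eq (ℕₚ.*-comm q d)))) m≤n))
    where
    pos : ∀ q → m ≡ q ℕ.* d → 1 ≤ q
    pos zero    refl = 1≤m
    pos (suc q) _    = s≤s z≤n
    to : ∀ x → d ℕ.* x ≡ m → q ≡ x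
    to x eq′ = to′ d (trans eq′ (trans eq (ℕₚ.*-comm q d))) eq
      where
      to′ : ∀ d → d ℕ.* x ≡ d ℕ.* q → m ≡ q ℕ.* d → q ≡ x
      to′ zero    _  e = ⊥-elim (ℕₚ.<⇒≢ 1≤m (sym (trans e (ℕₚ.*-zeroʳ q))))
      to′ (suc d) e′ _ = ℕₚ.*-cancelˡ-≡ q x (suc d) (sym e′)
  χ-∤ : ∀ d → ¬ d ∣ m → χ d ≡ 0ℤ
  χ-∤ d d∤m = ∑-zero-range n (λ x _ _ → δ-≢ (λ eq → d∤m (divides x (trans (sym eq) (ℕₚ.*-comm d x)))))

∑-δ-δ : ∀ n u v → 1 ≤ u → 1 ≤ v → ∑[ m ∈ 1⋯ (n ∸ 1) ] (δ u m * δ v (n ∸ m)) ≡ δ (u ℕ.+ v) n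
∑-δ-δ n u v 1≤u 1≤v = trans
  -- For `u` beyond `n ∸ 1`, truncated subtraction gives `n ∸ u ≡ 0`, which differs from `v`.
  (δ-∑ (n ∸ 1) u (λ m → δ v (n ∸ m)) 1≤u (λ n∸1<u → δ-≢ (λ v≡n∸u → ℕₚ.<⇒≢ 1≤v (sym
    (trans v≡n∸u (ℕₚ.m≤n⇒m∸n≡0 (ℕₚ.≤-trans (ℕₚ.m≤n+m∸n n 1) n∸1<u)))))))
  (δ-⇔ to (λ { refl → sym (ℕₚ.m+n∸m≡n u v) }))
  where
  to : v ≡ n ∸ u → u ℕ.+ v ≡ n
  to refl with u ℕ.≤? n
  ... | yes u≤n = ℕₚ.m+[n∸m]≡n u≤n
  ... | no  u≰n = ⊥-elim (ℕₚ.<⇒≢ 1≤v (sym (ℕₚ.m≤n⇒m∸n≡0 (ℕₚ.<⇒≤ (ℕₚ.≰⇒> u≰n)))))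

-- The divisors enter as a x = m and b y = n - m; summing over `m` leaves the single constraint a x
-- + b y = n.
convolution : ∀ n (φ ψ : ℕ → ℤ) →
  ∑[ m ∈ 1⋯ (n ∸ 1) ] (∑ (divisors m) φ * ∑ (divisors (n ∸ m)) ψ) ≡ L n (λ a b _ _ → φ a * ψ b)
convolution n φ ψ = begin
  ∑[ m ∈ 1⋯ (n ∸ 1) ] (∑ (divisors m) φ * ∑ (divisors (n ∸ m)) ψ)
    ≡⟨ ∑-cong-range (n ∸ 1) (λ m 1≤m m≤n∸1 → trans
         (cong₂ _*_ (∑-divisors n m φ 1≤m (ℕₚ.≤-trans m≤n∸1 (ℕₚ.m∸n≤m n 1)))
                    (∑-divisors n (n ∸ m) ψ (ℕₚ.m<n⇒0<n∸m (below 1≤m m≤n∸1)) (ℕₚ.m∸n≤m n m)))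
         (∑₂-*-∑₂ n _ _)) ⟩
  ∑[ m ∈ 1⋯ (n ∸ 1) ] ∑₂ n (λ a b → ∑₂ n (λ x y → δ (a ℕ.* x) m * φ a * (δ (b ℕ.* y) (n ∸ m) * ψ b)))
    ≡⟨ trans (∑-∑₂-comm (1⋯ (n ∸ 1)) n _) (∑₂-cong n (λ a b → ∑-∑₂-comm (1⋯ (n ∸ 1)) n _)) ⟩
  ∑₂ n (λ a b → ∑₂ n (λ x y → ∑[ m ∈ 1⋯ (n ∸ 1) ] (δ (a ℕ.* x) m * φ a * (δ (b ℕ.* y) (n ∸ m) * ψ b))))
    ≡⟨ ∑₂-cong-range n (λ a b 1≤a 1≤b → ∑₂-cong-range n (λ x y 1≤x 1≤y → trans
         (∑-cong (1⋯ (n ∸ 1)) (λ m → interchange (δ (a ℕ.* x) m) (φ a) (δ (b ℕ.* y) (n ∸ m)) (ψ b)))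
         (trans (∑-*ʳ (1⋯ (n ∸ 1)) (λ m → δ (a ℕ.* x) m * δ (b ℕ.* y) (n ∸ m)) (φ a * ψ b))
                (cong (_* (φ a * ψ b)) (∑-δ-δ n (a ℕ.* x) (b ℕ.* y) (ℕₚ.*-mono-≤ 1≤a 1≤x) (ℕₚ.*-mono-≤ 1≤b 1≤y)))))) ⟩
  L n (λ a b _ _ → φ a * ψ b) ∎
  where
  interchange : ∀ i j k l → i * j * (k * l) ≡ i * k * (j * l)
  interchange = solve-∀
  below : ∀ {m} → 1 ≤ m → m ≤ n ∸ 1 → m < n
  below {suc m} _ m<n∸1 = aux n m<n∸1
    where
    aux : ∀ n → suc m ≤ n ∸ 1 → suc m < n
    aux (suc n) m<n = s≤s m<n

-- Evaluation of the sum over the boundary x = y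

-- Substituting a = 2i and d = 2i + b in the sum over x (a + b) = n with a even.
even-pairs : ∀ n → 1 ≤ n → (f : ℕ → ℕ → ℤ) →
  ∑[ x ∈ 1⋯ n ] ∑₂ n (λ a b → δ (x ℕ.* a ℕ.+ x ℕ.* b) n * (even (parity a) * f a b)) ≡
  ∑[ d ∈ divisors n ] ∑[ i ∈ 1⋯ n ] ((∑[ b ∈ 1⋯ n ] δ (2 ℕ.* i ℕ.+ b) d) * f (2 ℕ.* i) (d ∸ 2 ℕ.* i))
even-pairs n 1≤n f = begin
  ∑[ x ∈ 1⋯ n ] ∑₂ n (λ a b → δ (x ℕ.* a ℕ.+ x ℕ.* b) n * (even (parity a) * f a b))
    ≡⟨ ∑-cong-range n (λ x 1≤x _ → per-x x 1≤x) ⟩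
  ∑[ x ∈ 1⋯ n ] ∑[ d ∈ 1⋯ n ] (δ (d ℕ.* x) n * S d)
    ≡⟨ ∑-comm (1⋯ n) (1⋯ n) (λ x d → δ (d ℕ.* x) n * S d) ⟩
  ∑₂ n (λ d x → δ (d ℕ.* x) n * S d)
    ≡⟨ ∑-divisors n n S 1≤n ℕₚ.≤-refl ⟨
  ∑[ d ∈ divisors n ] S d ∎
  where
  θ : ℕ → ℕ → ℤ
  θ i d = ∑[ b ∈ 1⋯ n ] δ (2 ℕ.* i ℕ.+ b) d
  S : ℕ → ℤ
  S d = ∑[ i ∈ 1⋯ n ] (θ i d * f (2 ℕ.* i) (d ∸ 2 ℕ.* i))
  per-x : ∀ x → 1 ≤ x →
    ∑₂ n (λ a b → δ (x ℕ.* a ℕ.+ x ℕ.* b) n * (even (parity a) * f a b)) ≡ ∑[ d ∈ 1⋯ n ] (δ (d ℕ.* x) n * S d)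
  per-x x 1≤x = begin
    ∑₂ n (λ a b → δ (x ℕ.* a ℕ.+ x ℕ.* b) n * (even (parity a) * f a b))
      ≡⟨ ∑-cong (1⋯ n) (λ a → trans
           (∑-cong (1⋯ n) (λ b → *-leftComm (δ (x ℕ.* a ℕ.+ x ℕ.* b) n) (even (parity a)) (f a b)))
           (∑-*ˡ (1⋯ n) (even (parity a)) (λ b → δ (x ℕ.* a ℕ.+ x ℕ.* b) n * f a b))) ⟩
    ∑[ a ∈ 1⋯ n ] (even (parity a) * row a)
      ≡⟨ ∑-even n row (λ a n<a → ∑-zero-range n (λ b _ _ → cong (_* f a b) (δ-≢ (ℕₚ.>⇒≢
           (subst (λ m → n < m ℕ.+ x ℕ.* b) (ℕₚ.*-comm a x) (<-*-+ (x ℕ.* b) n<a 1≤x)))))) ⟩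
    ∑₂ n (λ i b → δ (x ℕ.* (2 ℕ.* i) ℕ.+ x ℕ.* b) n * f (2 ℕ.* i) b)
      -- With `d = 2 * i + b`, the entry `b` becomes `d ∸ 2 * i`, so the summand depends on `b`
      -- through `d` alone.
      ≡⟨ ∑₂-cong n (λ i b → cong₂ (λ m c → δ m n * f (2 ℕ.* i) c)
           (trans (sym (ℕₚ.*-distribˡ-+ x (2 ℕ.* i) b)) (ℕₚ.*-comm x (2 ℕ.* i ℕ.+ b)))
           (sym (ℕₚ.m+n∸m≡n (2 ℕ.* i) b))) ⟩
    ∑₂ n (λ i b → column i (2 ℕ.* i ℕ.+ b))
      ≡⟨ ∑-cong (1⋯ n) (λ i → ∑-reindex n n (2 ℕ.* i ℕ.+_) (column i)
           (λ b 1≤b → ℕₚ.≤-trans 1≤b (ℕₚ.m≤n+m b (2 ℕ.* i))) (column-vanish i)) ⟩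
    ∑₂ n (λ i d → θ i d * column i d)
      ≡⟨ ∑₂-comm n (λ i d → θ i d * column i d) ⟩
    ∑₂ n (λ d i → θ i d * column i d)
      ≡⟨ ∑-cong (1⋯ n) (λ d → trans
           (∑-cong (1⋯ n) (λ i → *-leftComm (θ i d) (δ (d ℕ.* x) n) (f (2 ℕ.* i) (d ∸ 2 ℕ.* i))))
           (∑-*ˡ (1⋯ n) (δ (d ℕ.* x) n) (λ i → θ i d * f (2 ℕ.* i) (d ∸ 2 ℕ.* i)))) ⟩
    ∑[ d ∈ 1⋯ n ] (δ (d ℕ.* x) n * S d) ∎
    where
    row : ℕ → ℤ
    row a = ∑[ b ∈ 1⋯ n ] (δ (x ℕ.* a ℕ.+ x ℕ.* b) n * f a b)
    column : ℕ → ℕ → ℤ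
    column i d = δ (d ℕ.* x) n * f (2 ℕ.* i) (d ∸ 2 ℕ.* i)
    column-vanish : ∀ i d → n < d → column i d ≡ 0ℤ
    column-vanish i d n<d = cong (_* f (2 ℕ.* i) (d ∸ 2 ℕ.* i)) (δ-≢ (ℕₚ.>⇒≢
      (subst (n <_) (ℕₚ.+-identityʳ (d ℕ.* x)) (<-*-+ 0 n<d 1≤x))))

-- The inner sum is the indicator of `2 * i < 2 * j + 1`, that is, of `i ≤ j`.
∑-below : ∀ n j (h : ℕ → ℤ) → suc (2 ℕ.* j) ≤ n →
  ∑[ i ∈ 1⋯ n ] ((∑[ b ∈ 1⋯ n ] δ (2 ℕ.* i ℕ.+ b) (suc (2 ℕ.* j))) * h i) ≡ ∑ (1⋯ j) h
∑-below n j h d≤n = sym (trans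
  (∑-cong-range j (λ i _ i≤j → sym (trans (cong (_* h i) (∑-δ-< n (s≤s (ℕₚ.*-monoʳ-≤ 2 i≤j)) d≤n)) (*-identityˡ (h i)))))
  (∑-extend (ℕₚ.≤-trans (ℕₚ.m≤m+n j _) (ℕₚ.<⇒≤ d≤n))
    (λ i j<i → cong (_* h i) (∑-δ-≥ n (ℕₚ.≤-trans (ℕₚ.n≤1+n _) (ℕₚ.≤-trans
      (ℕₚ.≤-reflexive (cong suc (sym (ℕₚ.+-suc j (j ℕ.+ 0))))) (ℕₚ.*-monoʳ-≤ 2 j<i)))))))

-- `h` is an antidifference of `c * f a (d - a)` in `a` with step 2. The even `a` run from 2 to
-- `2 * j`, which is d - 1, so the telescope ends at d + 1. The factor `c` allows denominators in
-- `h` to be cleared.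
∑-telescope-even : ∀ c (f h : ℤ → ℤ → ℤ) → (∀ a d → h (a + + 2) d - h a d ≡ c * f a (d - a)) → ∀ j →
  c * (∑[ i ∈ 1⋯ j ] f (+ (2 ℕ.* i)) (+ (suc (2 ℕ.* j) ∸ 2 ℕ.* i))) ≡
  h (+ suc (2 ℕ.* j) + 1ℤ) (+ suc (2 ℕ.* j)) - h (+ 2) (+ suc (2 ℕ.* j))
∑-telescope-even c f h step j = begin
  c * (∑[ i ∈ 1⋯ j ] f (+ (2 ℕ.* i)) (+ (d ∸ 2 ℕ.* i)))
    ≡⟨ ∑-*ˡ (1⋯ j) c (λ i → f (+ (2 ℕ.* i)) (+ (d ∸ 2 ℕ.* i))) ⟨
  ∑[ i ∈ 1⋯ j ] (c * f (+ (2 ℕ.* i)) (+ (d ∸ 2 ℕ.* i)))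
    ≡⟨ ∑-cong-range j (λ i _ i≤j → difference i (ℕₚ.≤-trans (ℕₚ.*-monoʳ-≤ 2 i≤j) (ℕₚ.n≤1+n _))) ⟩
  ∑[ i ∈ 1⋯ j ] (h (+ (2 ℕ.* suc i)) (+ d) - h (+ (2 ℕ.* i)) (+ d))
    ≡⟨ ∑-telescope j (λ i → h (+ (2 ℕ.* i)) (+ d)) ⟩
  h (+ (2 ℕ.* suc j)) (+ d) - h (+ 2) (+ d)
    ≡⟨ cong (λ z → h (+ z) (+ d) - h (+ 2) (+ d)) (2*suc j) ⟩
  h (+ d + 1ℤ) (+ d) - h (+ 2) (+ d) ∎
  where
  d : ℕ
  d = suc (2 ℕ.* j)
  2*suc : ∀ i → 2 ℕ.* suc i ≡ suc (2 ℕ.* i) ℕ.+ 1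
  2*suc = ℕ-Solver.solve-∀
  2*suc′ : ∀ i → 2 ℕ.* i ℕ.+ 2 ≡ 2 ℕ.* suc i
  2*suc′ = ℕ-Solver.solve-∀
  difference : ∀ i → 2 ℕ.* i ≤ d →
    c * f (+ (2 ℕ.* i)) (+ (d ∸ 2 ℕ.* i)) ≡ h (+ (2 ℕ.* suc i)) (+ d) - h (+ (2 ℕ.* i)) (+ d)
  difference i 2i≤d = begin
    c * f (+ (2 ℕ.* i)) (+ (d ∸ 2 ℕ.* i))
      ≡⟨ cong (λ z → c * f (+ (2 ℕ.* i)) z) (trans (sym (⊖-≥ 2i≤d)) (sym (m-n≡m⊖n d (2 ℕ.* i)))) ⟩
    c * f (+ (2 ℕ.* i)) (+ d - + (2 ℕ.* i))
      ≡⟨ step (+ (2 ℕ.* i)) (+ d) ⟨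
    h (+ (2 ℕ.* i) + + 2) (+ d) - h (+ (2 ℕ.* i)) (+ d)
      ≡⟨ cong (λ z → h (+ z) (+ d) - h (+ (2 ℕ.* i)) (+ d)) (2*suc′ i) ⟩
    h (+ (2 ℕ.* suc i)) (+ d) - h (+ (2 ℕ.* i)) (+ d) ∎

-- As x (a + b) = n is odd, exactly one of `a` and `b` is even. The two cases are mirror images,
-- whence the factor 2, and `even-pairs` groups the first by the divisor d = a + b.
boundary-sum : ∀ n → 1 ≤ n → parity n ≡ 1ℙ → ∀ (k : Weight) (f : ℕ → ℕ → ℤ) c (h : ℕ → ℤ) →
  (∀ a b x → x ℕ.* a ℕ.+ x ℕ.* b ≡ n → k a b x x ≡ even (parity a) * f a b + even (parity b) * f b a) →
  (∀ j → c * (∑[ i ∈ 1⋯ j ] f (2 ℕ.* i) (suc (2 ℕ.* j) ∸ 2 ℕ.* i)) ≡ h (suc (2 ℕ.* j))) →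
  c * (∑[ x ∈ 1⋯ n ] ∑₂ n (λ a b → δ (x ℕ.* a ℕ.+ x ℕ.* b) n * k a b x x)) ≡ + 2 * ∑ (divisors n) h
boundary-sum n 1≤n odd k f c h k-even f-sum = begin
  c * (∑[ x ∈ 1⋯ n ] ∑₂ n (λ a b → δ (x ℕ.* a ℕ.+ x ℕ.* b) n * k a b x x))
    ≡⟨ cong (c *_) (∑-cong (1⋯ n) per-x) ⟩
  c * (∑[ x ∈ 1⋯ n ] (+ 2 * ∑₂ n (pairs x)))
    ≡⟨ cong (c *_) (trans (∑-*ˡ (1⋯ n) (+ 2) (λ x → ∑₂ n (pairs x))) (cong (+ 2 *_) (even-pairs n 1≤n f))) ⟩
  c * (+ 2 * ∑ (divisors n) S)
    ≡⟨ *-leftComm c (+ 2) (∑ (divisors n) S) ⟩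
  + 2 * (c * ∑ (divisors n) S)
    ≡⟨ cong (+ 2 *_) (∑-*ˡ (divisors n) c S) ⟨
  + 2 * (∑[ d ∈ divisors n ] (c * S d))
    ≡⟨ cong (+ 2 *_) (∑-divisors n n (λ d → c * S d) 1≤n ℕₚ.≤-refl) ⟩
  + 2 * ∑₂ n (λ d x → δ (d ℕ.* x) n * (c * S d))
    -- In this form `δ-guard` supplies d x = n, so that `d` is odd and at most `n`, as `f-sum` and
    -- `∑-below` require.
    ≡⟨ cong (+ 2 *_) (∑₂-cong-range n (λ d x _ 1≤x → δ-guard (S-eval d x 1≤x))) ⟩
  + 2 * ∑₂ n (λ d x → δ (d ℕ.* x) n * h d)
    ≡⟨ cong (+ 2 *_) (∑-divisors n n h 1≤n ℕₚ.≤-refl) ⟨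
  + 2 * ∑ (divisors n) h ∎
  where
  pairs : ℕ → ℕ → ℕ → ℤ
  pairs x a b = δ (x ℕ.* a ℕ.+ x ℕ.* b) n * (even (parity a) * f a b)
  S : ℕ → ℤ
  S d = ∑[ i ∈ 1⋯ n ] ((∑[ b ∈ 1⋯ n ] δ (2 ℕ.* i ℕ.+ b) d) * f (2 ℕ.* i) (d ∸ 2 ℕ.* i))
  per-x : ∀ x → ∑₂ n (λ a b → δ (x ℕ.* a ℕ.+ x ℕ.* b) n * k a b x x) ≡ + 2 * ∑₂ n (pairs x)
  per-x x = begin
    ∑₂ n (λ a b → δ (x ℕ.* a ℕ.+ x ℕ.* b) n * k a b x x)
      ≡⟨ ∑₂-cong n (λ a b → trans (δ-guard (k-even a b x))
           (*-distribˡ-+ (δ (x ℕ.* a ℕ.+ x ℕ.* b) n) (even (parity a) * f a b) (even (parity b) * f b a))) ⟩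
    ∑₂ n (λ a b → pairs x a b + δ (x ℕ.* a ℕ.+ x ℕ.* b) n * (even (parity b) * f b a))
      ≡⟨ ∑₂-cong n (λ a b → cong (λ m → pairs x a b + δ m n * (even (parity b) * f b a)) (ℕₚ.+-comm (x ℕ.* a) (x ℕ.* b))) ⟩
    ∑₂ n (λ a b → pairs x a b + pairs x b a)
      ≡⟨ ∑₂-+ n (pairs x) (λ a b → pairs x b a) ⟩
    ∑₂ n (pairs x) + ∑₂ n (λ a b → pairs x b a)
      ≡⟨ cong (_+_ (∑₂ n (pairs x))) (∑₂-comm n (λ a b → pairs x b a)) ⟩
    ∑₂ n (pairs x) + ∑₂ n (pairs x)
      ≡⟨ i+i≡2*i (∑₂ n (pairs x)) ⟩
    + 2 * ∑₂ n (pairs x) ∎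
  odd-factor : ∀ p q → p ℙ.* q ≡ 1ℙ → p ≡ 1ℙ
  odd-factor 1ℙ q _ = refl
  S-eval : ∀ d x → 1 ≤ x → d ℕ.* x ≡ n → c * S d ≡ h d
  S-eval d x 1≤x dx≡n with halve d
  ... | twice j = ⊥-elim (0ℙ≢1ℙ (trans (sym (parity-2* j)) (odd-factor _ (parity x)
    (trans (sym (ℙₚ.*-homo-* (2 ℕ.* j) x)) (trans (cong parity dx≡n) odd)))))
  ... | twice+ j = trans (cong (c *_) (∑-below n j (λ i → f (2 ℕ.* i) (suc (2 ℕ.* j) ∸ 2 ℕ.* i))
    (ℕₚ.≤-trans (ℕₚ.m≤m*n (suc (2 ℕ.* j)) x ⦃ ℕ.>-nonZero 1≤x ⦄) (ℕₚ.≤-reflexive dx≡n)))) (f-sum j)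

-- Linear reduction to the convolutions

-- Exchanging (a, x) and (b, y) preserves the sum, so both halves of `k` contribute `L n u`; the
-- correction in `u` sums to zero by `L-halve`.
L-decompose : ∀ n (k u t : Weight) (φ : ℕ → ℕ → ℤ) →
  (∀ a b x y → a ℕ.* x ℕ.+ b ℕ.* y ≡ n → k a b x y ≡ u a b x y + u b a y x) →
  (∀ a b x y → u a b x y ≡ t a b x y + (even (parity x) * φ (2 ℕ.* a) b - even (parity a) * φ a b)) →
  L n k ≡ + 2 * L n t
L-decompose n k u t φ k-eq u-eq = begin
  L n k
    ≡⟨ L-cong n k-eq ⟩
  L n (λ a b x y → u a b x y + u b a y x)
    ≡⟨ L-+ n u (λ a b x y → u b a y x) ⟩
  L n u + L n (λ a b x y → u b a y x)
    ≡⟨ cong (_+_ (L n u)) (L-swap n u) ⟨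
  L n u + L n u
    ≡⟨ cong (λ i → i + i) (trans (L-cong n (λ a b x y _ → u-eq a b x y))
         (trans (L-+ n t (λ a b x y → v a b x y - w a b x y)) (cong (_+_ (L n t)) (L-minus n v w)))) ⟩
  (L n t + (L n v - L n w)) + (L n t + (L n v - L n w))
    ≡⟨ cong (λ i → (L n t + (L n v - i)) + (L n t + (L n v - i))) (L-halve n φ) ⟩
  (L n t + (L n v - L n v)) + (L n t + (L n v - L n v))
    ≡⟨ cancel (L n t) (L n v) ⟩
  + 2 * L n t ∎
  where
  v w : Weight
  v a b x y = even (parity x) * φ (2 ℕ.* a) b
  w a b x y = even (parity a) * φ a b
  cancel : ∀ i j → (i + (j - j)) + (i + (j - j)) ≡ + 2 * i
  cancel = solve-∀

convolution-difference : ∀ n (φ : ℕ → ℕ → ℤ) →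
  ∑[ m ∈ 1⋯ (n ∸ 1) ] (∑ (divisors m) (φ 3) * ∑ (divisors (n ∸ m)) (φ 7) - ∑ (divisors m) (φ 5) * ∑ (divisors (n ∸ m)) (φ 5)) ≡
  L n (λ a b _ _ → φ 3 a * φ 7 b) - L n (λ a b _ _ → φ 5 a * φ 5 b)
convolution-difference n φ = trans
  (∑-minus (1⋯ (n ∸ 1)) _ _)
  (cong₂ _-_ (convolution n (φ 3) (φ 7)) (convolution n (φ 5) (φ 5)))

-- Expanding separates the signed part, which leads to `σ†`, from the unsigned part. It is applied
-- with (-1)^d for `s d` and d^r for `p r d`.
L-products : ∀ n e c c′ (t : Weight) (s : ℕ → ℤ) (p : ℕ → ℕ → ℤ) →
  (∀ a b x y → t a b x y ≡ (c * (s a * s b) + c′) * (p 3 a * p 7 b - p 5 a * p 5 b)) →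
  e * L n t ≡
    e * c * (L n (λ a b _ _ → s a * p 3 a * (s b * p 7 b)) - L n (λ a b _ _ → s a * p 5 a * (s b * p 5 b)))
    + e * c′ * (L n (λ a b _ _ → p 3 a * p 7 b) - L n (λ a b _ _ → p 5 a * p 5 b))
L-products n e c c′ t s p t-eq = begin
  e * L n t
    ≡⟨ cong (e *_) (L-cong n (λ a b x y _ → trans (t-eq a b x y)
         (expand c c′ (s a) (s b) (p 3 a) (p 7 b) (p 5 a) (p 5 b)))) ⟩
  e * L n (λ a b x y → (c * F₁ a b x y + c′ * F₃ a b x y) - (c * F₂ a b x y + c′ * F₄ a b x y))
    ≡⟨ cong (e *_) (trans (L-minus n (λ a b x y → c * F₁ a b x y + c′ * F₃ a b x y) (λ a b x y → c * F₂ a b x y + c′ * F₄ a b x y))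
         (cong₂ _-_ (linear F₁ F₃) (linear F₂ F₄))) ⟩
  e * ((c * L n F₁ + c′ * L n F₃) - (c * L n F₂ + c′ * L n F₄))
    ≡⟨ regroup e c c′ (L n F₁) (L n F₂) (L n F₃) (L n F₄) ⟩
  e * c * (L n F₁ - L n F₂) + e * c′ * (L n F₃ - L n F₄) ∎
  where
  F₁ F₂ F₃ F₄ : Weight
  F₁ a b _ _ = s a * p 3 a * (s b * p 7 b)
  F₂ a b _ _ = s a * p 5 a * (s b * p 5 b)
  F₃ a b _ _ = p 3 a * p 7 b
  F₄ a b _ _ = p 5 a * p 5 b
  linear : ∀ F F′ → L n (λ a b x y → c * F a b x y + c′ * F′ a b x y) ≡ c * L n F + c′ * L n F′
  linear F F′ = trans (L-+ n (λ a b x y → c * F a b x y) (λ a b x y → c′ * F′ a b x y))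
    (cong₂ _+_ (L-*ˡ n c F) (L-*ˡ n c′ F′))
  regroup : ∀ e c c′ i j k l → e * ((c * i + c′ * k) - (c * j + c′ * l)) ≡ e * c * (i - j) + e * c′ * (k - l)
  regroup = solve-∀
  expand : ∀ c c′ s s′ i j k l → (c * (s * s′) + c′) * (i * j - k * l) ≡
    (c * (s * i * (s′ * j)) + c′ * (i * j)) - (c * (s * k * (s′ * l)) + c′ * (k * l))
  expand = solve-∀

-- Polynomials in two variables, as syntax for the ring solver

Poly : Set
Poly = Expr ℤ 2

𝑎 𝑏 : Poly
𝑎 = Ι zero
𝑏 = Ι (suc zero)

⟪_⟫ : Poly → ℤ → ℤ → ℤ
⟪ e ⟫ a b = ⟦ e ⟧ (a ∷ b ∷ [])

infixl 9 _[_,_]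
-- Substitution acts on syntax, so that both sides of an identity remain expressions that `norm` can
-- compare.
_[_,_] : Poly → Poly → Poly → Poly
Κ c          [ u , v ] = Κ c
Ι zero       [ u , v ] = u
Ι (suc zero) [ u , v ] = v
(d ⊕ e)      [ u , v ] = d [ u , v ] ⊕ e [ u , v ]
(d ⊗ e)      [ u , v ] = d [ u , v ] ⊗ e [ u , v ]
(e ⊛ i)      [ u , v ] = e [ u , v ] ⊛ i
(⊝ e)        [ u , v ] = ⊝ (e [ u , v ])

⟪⟫-[] : ∀ e u v a b → ⟪ e [ u , v ] ⟫ a b ≡ ⟪ e ⟫ (⟪ u ⟫ a b) (⟪ v ⟫ a b)
⟪⟫-[] (Κ c)          u v a b = refl
⟪⟫-[] (Ι zero)       u v a b = refl
⟪⟫-[] (Ι (suc zero)) u v a b = refl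
⟪⟫-[] (d ⊕ e)        u v a b = cong₂ _+_ (⟪⟫-[] d u v a b) (⟪⟫-[] e u v a b)
⟪⟫-[] (d ⊗ e)        u v a b = cong₂ _*_ (⟪⟫-[] d u v a b) (⟪⟫-[] e u v a b)
-- `⟪ 𝑎 ⊛ i ⟫ z 0ℤ` expresses the solver's own i-th power of `z`; the 0 is a dummy value for `𝑏`.
⟪⟫-[] (e ⊛ i)        u v a b = cong (λ z → ⟪ 𝑎 ⊛ i ⟫ z 0ℤ) (⟪⟫-[] e u v a b)
⟪⟫-[] (⊝ e)          u v a b = cong -_ (⟪⟫-[] e u v a b)

-- The second argument is meant for the polynomial of the exchanged parities; the result is then
-- invariant under exchanging (a, x) and (b, y).
symmetrize : Poly → Poly → Poly
symmetrize d e = d ⊕ e [ 𝑏 , 𝑎 ]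

⟪⟫-symmetrize : ∀ d e a b → ⟪ symmetrize d e ⟫ a b ≡ ⟪ d ⟫ a b + ⟪ e ⟫ b a
⟪⟫-symmetrize d e a b = cong (_+_ (⟪ d ⟫ a b)) (⟪⟫-[] e 𝑏 𝑎 a b)

⟪⟫-symmetrize-swap : ∀ d e a b → ⟪ symmetrize d e ⟫ a b ≡ ⟪ symmetrize e d ⟫ b a
⟪⟫-symmetrize-swap d e a b = begin
  ⟪ symmetrize d e ⟫ a b    ≡⟨ ⟪⟫-symmetrize d e a b ⟩
  ⟪ d ⟫ a b + ⟪ e ⟫ b a     ≡⟨ +-comm (⟪ d ⟫ a b) (⟪ e ⟫ b a) ⟩
  ⟪ e ⟫ b a + ⟪ d ⟫ a b     ≡⟨ ⟪⟫-symmetrize e d b a ⟨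
  ⟪ symmetrize e d ⟫ b a    ∎

-- Stated for variables d and e: comparing the values of two concrete polynomials by conversion
-- takes exponential time, because the multiplication of ℤ duplicates its arguments.  The local
-- lemmas eval below are general for the same reason.
⟪⟫-norm : ∀ d e → norm d ≡ norm e → ∀ a b → ⟪ d ⟫ a b ≡ ⟪ e ⟫ a b
⟪⟫-norm d e eq a b = trans (sym (correct d ρ)) (trans (cong (λ p → ⟦ p ⟧ₚ ρ) eq) (correct e ρ))
  where
  ρ : Vec ℤ 2
  ρ = a ∷ b ∷ []

power : Poly → ℕ → Poly
power e zero    = Κ 1ℤ
power e (suc k) = e ⊗ power e k

⟪power-𝑎⟫ : ∀ k a b → ⟪ power 𝑎 k ⟫ a b ≡ a ^ k
⟪power-𝑎⟫ zero    a b = refl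
⟪power-𝑎⟫ (suc k) a b = cong (a *_) (⟪power-𝑎⟫ k a b)

⟪power-𝑏⟫ : ∀ k a b → ⟪ power 𝑏 k ⟫ a b ≡ b ^ k
⟪power-𝑏⟫ zero    a b = refl
⟪power-𝑏⟫ (suc k) a b = cong (b *_) (⟪power-𝑏⟫ k a b)

-- Homogeneous; the i-th coefficient belongs to 𝑎^i.
form : List ℤ → Poly
form []       = Κ 0ℤ
form (c ∷ cs) = Κ c ⊗ power 𝑏 (length cs) ⊕ 𝑎 ⊗ form cs

-- The weight polynomials

-- The polynomials A, B, C and g solve the linear system expressed by T-step and T-diagonal, in which
-- the parameters p, q, r, s stand for the parities of a, b, x, y.
A B C : Poly
A = power 𝑎 2 ⊗ power 𝑏 2 ⊗ form (+ 472 ∷ + 3040 ∷ + 7082 ∷ + 7438 ∷ + 3689 ∷ + 1024 ∷ + 259 ∷ [])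
B = power 𝑎 2 ⊗ power 𝑏 2 ⊗ form (+ 472 ∷ + 736 ∷ - + 982 ∷ - + 2354 ∷ - + 631 ∷ + 1024 ∷ + 547 ∷ [])
C = power 𝑎 2 ⊗ power 𝑏 2 ⊗ form (+ 547 ∷ + 3352 ∷ + 7517 ∷ + 7696 ∷ + 3773 ∷ + 1048 ∷ + 259 ∷ [])

-- The three odd classes with `b` and `y` odd; `symmetrize` supplies their mirror images, in which
-- `a` and `x` are odd. Where a x + b y is even, the weight is zero.
K₀ : (p q r s : Parity) → Poly
K₀ 0ℙ 1ℙ 0ℙ 1ℙ = A
K₀ 0ℙ 1ℙ 1ℙ 1ℙ = B
K₀ 1ℙ 1ℙ 0ℙ 1ℙ = C
K₀ _  _  _  _  = Κ 0ℤ

K : (p q r s : Parity) → Poly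
K p q r s = symmetrize (K₀ p q r s) (K₀ q p s r)

g : Poly
g = Κ (+ 576) ⊗ (power 𝑎 3 ⊗ power 𝑏 7) ⊕ Κ (+ 612) ⊗ (power 𝑎 5 ⊗ power 𝑏 5)

summand : (p q : Parity) → Poly
summand p q = Κ (+ 24 * (sgn p * sgn q) + + 2072) ⊗ (power 𝑎 3 ⊗ power 𝑏 7 ⊕ ⊝ (power 𝑎 5 ⊗ power 𝑏 5))

-- The correction in g has sum zero, by L-halve.
U : (p q r : Parity) → Poly
U p q r = summand p q ⊕ (Κ (even r) ⊗ g [ Κ (+ 2) ⊗ 𝑎 , 𝑏 ] ⊕ ⊝ (Κ (even p) ⊗ g))

whenOdd : Parity → Poly → Poly
whenOdd 0ℙ e = Κ 0ℤ
whenOdd 1ℙ e = e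

-- Cut off where a x + b y is even. `K` is zero there too and the Euclidean step preserves this
-- parity, so `T-step` can hold for all parities.
T : (p q r s : Parity) → Poly
T p q r s = whenOdd ((p ℙ.* r) ℙ.+ (q ℙ.* s)) (symmetrize (U p q r) (U q p s))

-- H is an antidifference of 90 B(𝑎, 𝑏 - 𝑎) in 𝑎 with step 2; here 𝑏 stands for the divisor d.
H P : Poly
H = 𝑎 ⊗ power 𝑏 2 ⊗
  ( power 𝑎 2 ⊗ form (+ 7080 ∷ - + 34200 ∷ + 63738 ∷ - + 55785 ∷ + 23715 ∷ - + 5760 ∷ + 1295 ∷ [])
  ⊕ 𝑎 ⊗ form (- + 21240 ∷ + 136800 ∷ - + 318690 ∷ + 334710 ∷ - + 166005 ∷ + 46080 ∷ - + 11655 ∷ [])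
  ⊕ form (+ 14160 ∷ - + 136800 ∷ + 424920 ∷ - + 557850 ∷ + 332010 ∷ - + 107520 ∷ + 31080 ∷ [])
  ⊕ form (- + 169968 ∷ + 446280 ∷ - + 442680 ∷ + 215040 ∷ - + 87024 ∷ [])
  ⊕ form (+ 252960 ∷ - + 245760 ∷ + 165760 ∷ [])
  ⊕ Κ (- + 99456))
P = Κ (+ 759) ⊗ power 𝑏 3 ⊕ ⊝ (Κ (+ 200) ⊗ power 𝑏 5) ⊕ ⊝ (Κ (+ 642) ⊗ power 𝑏 7) ⊕ Κ (+ 83) ⊗ power 𝑏 11

-- Polynomial identities for the weights

-- `p` is the parity of `c`. For each of the sixteen parity choices the claim is a polynomial
-- identity, decided by comparing normal forms.
T-step : ∀ p q r s b c →
  ⟪ T (q ℙ.+ p) q r s ⟫ (b + c) b + ⟪ K p q r (r ℙ.+ s) ⟫ c b ≡ ⟪ K (q ℙ.+ p) q r s ⟫ (b + c) b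
T-step p q r s b c = begin
  ⟪ T (q ℙ.+ p) q r s ⟫ (b + c) b + ⟪ K p q r (r ℙ.+ s) ⟫ c b
    ≡⟨ cong₂ _+_ (⟪⟫-[] (T (q ℙ.+ p) q r s) (𝑎 ⊕ 𝑏) 𝑎 b c) (⟪⟫-[] (K p q r (r ℙ.+ s)) 𝑏 𝑎 b c) ⟨
  ⟪ lhs p q r s ⟫ b c
    ≡⟨ ⟪⟫-norm (lhs p q r s) (rhs p q r s) (norm-eq p q r s) b c ⟩
  ⟪ rhs p q r s ⟫ b c
    ≡⟨ ⟪⟫-[] (K (q ℙ.+ p) q r s) (𝑎 ⊕ 𝑏) 𝑎 b c ⟩
  ⟪ K (q ℙ.+ p) q r s ⟫ (b + c) b ∎
  where
  -- Here `𝑎` and `𝑏` stand for `b` and `c`.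
  lhs rhs : (p q r s : Parity) → Poly
  lhs p q r s = T (q ℙ.+ p) q r s [ 𝑎 ⊕ 𝑏 , 𝑎 ] ⊕ K p q r (r ℙ.+ s) [ 𝑏 , 𝑎 ]
  rhs p q r s = K (q ℙ.+ p) q r s [ 𝑎 ⊕ 𝑏 , 𝑎 ]
  norm-eq : ∀ p q r s → norm (lhs p q r s) ≡ norm (rhs p q r s)
  norm-eq 0ℙ 0ℙ 0ℙ 0ℙ = refl
  norm-eq 0ℙ 0ℙ 0ℙ 1ℙ = refl
  norm-eq 0ℙ 0ℙ 1ℙ 0ℙ = refl
  norm-eq 0ℙ 0ℙ 1ℙ 1ℙ = refl
  norm-eq 0ℙ 1ℙ 0ℙ 0ℙ = refl
  norm-eq 0ℙ 1ℙ 0ℙ 1ℙ = refl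
  norm-eq 0ℙ 1ℙ 1ℙ 0ℙ = refl
  norm-eq 0ℙ 1ℙ 1ℙ 1ℙ = refl
  norm-eq 1ℙ 0ℙ 0ℙ 0ℙ = refl
  norm-eq 1ℙ 0ℙ 0ℙ 1ℙ = refl
  norm-eq 1ℙ 0ℙ 1ℙ 0ℙ = refl
  norm-eq 1ℙ 0ℙ 1ℙ 1ℙ = refl
  norm-eq 1ℙ 1ℙ 0ℙ 0ℙ = refl
  norm-eq 1ℙ 1ℙ 0ℙ 1ℙ = refl
  norm-eq 1ℙ 1ℙ 1ℙ 0ℙ = refl
  norm-eq 1ℙ 1ℙ 1ℙ 1ℙ = refl

-- The limiting case c = 0 of `T-step`: the second weight drops out because `A`, `B` and `C` are
-- divisible by 𝑎² 𝑏².
T-diagonal : ∀ q r s b → ⟪ T q q r s ⟫ b b ≡ ⟪ K q q r s ⟫ b b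
T-diagonal q r s b = begin
  ⟪ T q q r s ⟫ b b            ≡⟨ ⟪⟫-[] (T q q r s) 𝑎 𝑎 b b ⟨
  ⟪ T q q r s [ 𝑎 , 𝑎 ] ⟫ b b  ≡⟨ ⟪⟫-norm (T q q r s [ 𝑎 , 𝑎 ]) (K q q r s [ 𝑎 , 𝑎 ]) (norm-eq q r s) b b ⟩
  ⟪ K q q r s [ 𝑎 , 𝑎 ] ⟫ b b  ≡⟨ ⟪⟫-[] (K q q r s) 𝑎 𝑎 b b ⟩
  ⟪ K q q r s ⟫ b b            ∎
  where
  norm-eq : ∀ q r s → norm (T q q r s [ 𝑎 , 𝑎 ]) ≡ norm (K q q r s [ 𝑎 , 𝑎 ])
  norm-eq 0ℙ 0ℙ 0ℙ = refl
  norm-eq 0ℙ 0ℙ 1ℙ = refl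
  norm-eq 0ℙ 1ℙ 0ℙ = refl
  norm-eq 0ℙ 1ℙ 1ℙ = refl
  norm-eq 1ℙ 0ℙ 0ℙ = refl
  norm-eq 1ℙ 0ℙ 1ℙ = refl
  norm-eq 1ℙ 1ℙ 0ℙ = refl
  norm-eq 1ℙ 1ℙ 1ℙ = refl

K-swap : ∀ p q r s a b → ⟪ K p q r s ⟫ a b ≡ ⟪ K q p s r ⟫ b a
K-swap p q r s = ⟪⟫-symmetrize-swap (K₀ p q r s) (K₀ q p s r)

T-swap : ∀ p q r s a b → ⟪ T p q r s ⟫ a b ≡ ⟪ T q p s r ⟫ b a
T-swap p q r s a b = trans (whenOdd-swap ((p ℙ.* r) ℙ.+ (q ℙ.* s)) (U p q r) (U q p s) a b)
  (cong (λ z → ⟪ whenOdd z (symmetrize (U q p s) (U p q r)) ⟫ b a) (ℙₚ.+-comm (p ℙ.* r) (q ℙ.* s)))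
  where
  whenOdd-swap : ∀ z d e a b → ⟪ whenOdd z (symmetrize d e) ⟫ a b ≡ ⟪ whenOdd z (symmetrize e d) ⟫ b a
  whenOdd-swap 0ℙ d e a b = refl
  whenOdd-swap 1ℙ d e a b = ⟪⟫-symmetrize-swap d e a b

T-odd : ∀ p q r s a b → (p ℙ.* r) ℙ.+ (q ℙ.* s) ≡ 1ℙ → ⟪ T p q r s ⟫ a b ≡ ⟪ U p q r ⟫ a b + ⟪ U q p s ⟫ b a
T-odd p q r s a b eq = trans (cong (λ z → ⟪ whenOdd z (symmetrize (U p q r) (U q p s)) ⟫ a b) eq)
  (⟪⟫-symmetrize (U p q r) (U q p s) a b)

-- An odd x (a + b) forces `x` to be odd and exactly one of `a`, `b` to be even; this leaves the
-- class of `B` and its mirror image.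
K-boundary : ∀ p q r a b → (r ℙ.* p) ℙ.+ (r ℙ.* q) ≡ 1ℙ →
  ⟪ K p q r r ⟫ a b ≡ even p * ⟪ B ⟫ a b + even q * ⟪ B ⟫ b a
K-boundary 0ℙ 1ℙ 1ℙ a b _ = trans (⟪⟫-symmetrize B (Κ 0ℤ) a b)
  (cong₂ _+_ (sym (*-identityˡ (⟪ B ⟫ a b))) (sym (*-zeroˡ (⟪ B ⟫ b a))))
K-boundary 1ℙ 0ℙ 1ℙ a b _ = trans (⟪⟫-symmetrize (Κ 0ℤ) B a b)
  (cong₂ _+_ (sym (*-zeroˡ (⟪ B ⟫ a b))) (sym (*-identityˡ (⟪ B ⟫ b a))))

⟪U⟫ : ∀ p q r a b → ⟪ U p q r ⟫ (+ a) (+ b) ≡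
  ⟪ summand p q ⟫ (+ a) (+ b) + (even r * ⟪ g ⟫ (+ (2 ℕ.* a)) (+ b) - even p * ⟪ g ⟫ (+ a) (+ b))
⟪U⟫ p q r = eval (summand p q) g (even r) (even p)
  where
  eval : ∀ d e i j a b → ⟪ d ⊕ (Κ i ⊗ e [ Κ (+ 2) ⊗ 𝑎 , 𝑏 ] ⊕ ⊝ (Κ j ⊗ e)) ⟫ (+ a) (+ b) ≡
    ⟪ d ⟫ (+ a) (+ b) + (i * ⟪ e ⟫ (+ (2 ℕ.* a)) (+ b) - j * ⟪ e ⟫ (+ a) (+ b))
  eval d e i j a b = cong (λ k → ⟪ d ⟫ (+ a) (+ b) + (i * k - j * ⟪ e ⟫ (+ a) (+ b)))
    (trans (⟪⟫-[] e (Κ (+ 2) ⊗ 𝑎) 𝑏 (+ a) (+ b)) (cong (λ z → ⟪ e ⟫ z (+ b)) (sym (pos-* 2 a))))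

⟪summand⟫ : ∀ p q a b → ⟪ summand p q ⟫ a b ≡ (+ 24 * (sgn p * sgn q) + + 2072) * (a ^ 3 * b ^ 7 - a ^ 5 * b ^ 5)
⟪summand⟫ p q a b = cong ((+ 24 * (sgn p * sgn q) + + 2072) *_)
  (cong₂ _-_ (cong₂ _*_ (⟪power-𝑎⟫ 3 a b) (⟪power-𝑏⟫ 7 a b)) (cong₂ _*_ (⟪power-𝑎⟫ 5 a b) (⟪power-𝑏⟫ 5 a b)))

H-step : ∀ a d → ⟪ H ⟫ (a + + 2) d - ⟪ H ⟫ a d ≡ + 90 * ⟪ B ⟫ a (d - a)
H-step a d = trans (sym (evalˡ H a d)) (trans
  (⟪⟫-norm (H [ 𝑎 ⊕ Κ (+ 2) , 𝑏 ] ⊕ ⊝ H) (Κ (+ 90) ⊗ B [ 𝑎 , 𝑏 ⊕ ⊝ 𝑎 ]) refl a d) (evalʳ B a d))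
  where
  evalˡ : ∀ e a d → ⟪ e [ 𝑎 ⊕ Κ (+ 2) , 𝑏 ] ⊕ ⊝ e ⟫ a d ≡ ⟪ e ⟫ (a + + 2) d - ⟪ e ⟫ a d
  evalˡ e a d = cong (_- ⟪ e ⟫ a d) (⟪⟫-[] e (𝑎 ⊕ Κ (+ 2)) 𝑏 a d)
  evalʳ : ∀ e a d → ⟪ Κ (+ 90) ⊗ e [ 𝑎 , 𝑏 ⊕ ⊝ 𝑎 ] ⟫ a d ≡ + 90 * ⟪ e ⟫ a (d - a)
  evalʳ e a d = cong (+ 90 *_) (⟪⟫-[] e 𝑎 (𝑏 ⊕ ⊝ 𝑎) a d)

-- The difference between the ends of the telescope over even `a`, which produces the coefficients
-- of the theorem. The 0 fills the variable `𝑎`, absent from `P`.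
H-range : ∀ d → ⟪ H ⟫ (d + 1ℤ) d - ⟪ H ⟫ (+ 2) d ≡ ⟪ P ⟫ 0ℤ d
H-range d = trans (sym (eval H d)) (⟪⟫-norm (H [ 𝑏 ⊕ Κ 1ℤ , 𝑏 ] ⊕ ⊝ (H [ Κ (+ 2) , 𝑏 ])) P refl 0ℤ d)
  where
  eval : ∀ e d → ⟪ e [ 𝑏 ⊕ Κ 1ℤ , 𝑏 ] ⊕ ⊝ (e [ Κ (+ 2) , 𝑏 ]) ⟫ 0ℤ d ≡ ⟪ e ⟫ (d + 1ℤ) d - ⟪ e ⟫ (+ 2) d
  eval e d = cong₂ _-_ (⟪⟫-[] e (𝑏 ⊕ Κ 1ℤ) 𝑏 0ℤ d) (⟪⟫-[] e (Κ (+ 2)) 𝑏 0ℤ d)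

-- The weights K and T

B-sum : ∀ j → + 90 * (∑[ i ∈ 1⋯ j ] ⟪ B ⟫ (+ (2 ℕ.* i)) (+ (suc (2 ℕ.* j) ∸ 2 ℕ.* i))) ≡ ⟪ P ⟫ 0ℤ (+ suc (2 ℕ.* j))
B-sum j = trans (∑-telescope-even (+ 90) ⟪ B ⟫ ⟪ H ⟫ H-step j) (H-range (+ suc (2 ℕ.* j)))

weight : ((p q r s : Parity) → Poly) → Weight
weight F a b x y = ⟪ F (parity a) (parity b) (parity x) (parity y) ⟫ (+ a) (+ b)

L-T : ∀ n → L n (weight T) ≡ ∑[ x ∈ 1⋯ n ] ∑₂ n (λ a b → δ (x ℕ.* a ℕ.+ x ℕ.* b) n * weight K a b x x)
L-T n = L-euclid n (weight K) (weight T)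
  (λ a b x y → K-swap (parity a) (parity b) (parity x) (parity y) (+ a) (+ b))
  (λ a b x y → T-swap (parity a) (parity b) (parity x) (parity y) (+ a) (+ b))
  step
  (λ b x y → T-diagonal (parity b) (parity x) (parity y) (+ b))
  where
  step : ∀ b c x y → weight T (b ℕ.+ c) b x y + weight K c b x (x ℕ.+ y) ≡ weight K (b ℕ.+ c) b x y
  step b c x y = begin
    weight T (b ℕ.+ c) b x y + weight K c b x (x ℕ.+ y)
      ≡⟨ cong₂ (λ p s → ⟪ T p (parity b) (parity x) (parity y) ⟫ (+ b + + c) (+ b) + ⟪ K (parity c) (parity b) (parity x) s ⟫ (+ c) (+ b))
           (ℙₚ.+-homo-+ b c) (ℙₚ.+-homo-+ x y) ⟩
    ⟪ T (parity b ℙ.+ parity c) (parity b) (parity x) (parity y) ⟫ (+ b + + c) (+ b) +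
    ⟪ K (parity c) (parity b) (parity x) (parity x ℙ.+ parity y) ⟫ (+ c) (+ b)
      ≡⟨ T-step (parity c) (parity b) (parity x) (parity y) (+ b) (+ c) ⟩
    ⟪ K (parity b ℙ.+ parity c) (parity b) (parity x) (parity y) ⟫ (+ b + + c) (+ b)
      ≡⟨ cong (λ p → ⟪ K p (parity b) (parity x) (parity y) ⟫ (+ b + + c) (+ b)) (ℙₚ.+-homo-+ b c) ⟨
    weight K (b ℕ.+ c) b x y ∎

L-T-divisors : ∀ n → 1 ≤ n → parity n ≡ 1ℙ →
  + 90 * L n (weight T) ≡ + 2 * (∑[ d ∈ divisors n ] ⟪ P ⟫ 0ℤ (+ d))
L-T-divisors n 1≤n odd = trans (cong (+ 90 *_) (L-T n))
  (boundary-sum n 1≤n odd (weight K) (λ a b → ⟪ B ⟫ (+ a) (+ b)) (+ 90) (λ d → ⟪ P ⟫ 0ℤ (+ d))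
    (λ a b x eq → K-boundary (parity a) (parity b) (parity x) (+ a) (+ b)
      (trans (sym (parity-*-+ x x a b)) (trans (cong parity eq) odd)))
    B-sum)

-- As `n` is odd, every quadruple falls in the branch of `whenOdd` that keeps the polynomial.
L-summand : ∀ n → parity n ≡ 1ℙ → L n (weight T) ≡ + 2 * L n (weight (λ p q r s → summand p q))
L-summand n odd = L-decompose n (weight T) (weight (λ p q r s → U p q r)) (weight (λ p q r s → summand p q))
  (λ a b → ⟪ g ⟫ (+ a) (+ b))
  (λ a b x y eq → T-odd (parity a) (parity b) (parity x) (parity y) (+ a) (+ b)
    (trans (sym (parity-*-+ a b x y)) (trans (cong parity eq) odd)))
  (λ a b x y → ⟪U⟫ (parity a) (parity b) (parity x) a b)

L-σ : ∀ n → + 90 * L n (weight (λ p q r s → summand p q)) ≡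
  (+ 2160) * (∑[ m ∈ 1⋯ (n ∸ 1) ] (σ† 3 m * σ† 7 (n ∸ m) - σ† 5 m * σ† 5 (n ∸ m)))
    + (+ 186480) * (∑[ m ∈ 1⋯ (n ∸ 1) ] (σ 3 m * σ 7 (n ∸ m) - σ 5 m * σ 5 (n ∸ m)))
L-σ n = begin
  + 90 * L n (weight (λ p q r s → summand p q))
    ≡⟨ L-products n (+ 90) (+ 24) (+ 2072) (weight (λ p q r s → summand p q)) (λ d → -1ℤ ^ d) (λ r d → (+ d) ^ r)
         (λ a b x y → trans (⟪summand⟫ (parity a) (parity b) (+ a) (+ b))
           (cong (λ c → (+ 24 * c + + 2072) * ((+ a) ^ 3 * (+ b) ^ 7 - (+ a) ^ 5 * (+ b) ^ 5))
             (cong₂ _*_ (sym (sgn-parity a)) (sym (sgn-parity b))))) ⟩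
  (+ 90 * + 24) * X† + (+ 90 * + 2072) * X
    -- 90 · 24 = 2160 and 90 · 2072 = 186480.
    ≡⟨ cong₂ (λ k l → k * X† + l * X) {x = + 90 * + 24} {y = + 2160} {u = + 90 * + 2072} {v = + 186480} refl refl ⟩
  + 2160 * X† + + 186480 * X
    ≡⟨ cong₂ (λ k l → + 2160 * k + + 186480 * l) X†-σ X-σ ⟩
  + 2160 * (∑[ m ∈ 1⋯ (n ∸ 1) ] (σ† 3 m * σ† 7 (n ∸ m) - σ† 5 m * σ† 5 (n ∸ m)))
    + + 186480 * (∑[ m ∈ 1⋯ (n ∸ 1) ] (σ 3 m * σ 7 (n ∸ m) - σ 5 m * σ 5 (n ∸ m))) ∎
  where
  X† X : ℤ
  X† = L n (λ a b _ _ → -1ℤ ^ a * (+ a) ^ 3 * (-1ℤ ^ b * (+ b) ^ 7)) - L n (λ a b _ _ → -1ℤ ^ a * (+ a) ^ 5 * (-1ℤ ^ b * (+ b) ^ 5))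
  X = L n (λ a b _ _ → (+ a) ^ 3 * (+ b) ^ 7) - L n (λ a b _ _ → (+ a) ^ 5 * (+ b) ^ 5)
  X†-σ : X† ≡ ∑[ m ∈ 1⋯ (n ∸ 1) ] (σ† 3 m * σ† 7 (n ∸ m) - σ† 5 m * σ† 5 (n ∸ m))
  X†-σ = sym (convolution-difference n (λ r d → -1ℤ ^ d * (+ d) ^ r))
  X-σ : X ≡ ∑[ m ∈ 1⋯ (n ∸ 1) ] (σ 3 m * σ 7 (n ∸ m) - σ 5 m * σ 5 (n ∸ m))
  X-σ = sym (convolution-difference n (λ r d → (+ d) ^ r))

∑-P : ∀ n → ∑[ d ∈ divisors n ] ⟪ P ⟫ 0ℤ (+ d) ≡
  (+ 759) * σ 3 n - (+ 200) * σ 5 n - (+ 642) * σ 7 n + (+ 83) * σ 11 n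
∑-P n = begin
  ∑[ d ∈ divisors n ] ⟪ P ⟫ 0ℤ (+ d)
    ≡⟨ ∑-cong (divisors n) pointwise ⟩
  ∑[ d ∈ divisors n ] (m 759 3 d - m 200 5 d - m 642 7 d + m 83 11 d)
    ≡⟨ trans (∑-+ (divisors n) (λ d → m 759 3 d - m 200 5 d - m 642 7 d) (m 83 11)) (cong (_+ ∑ (divisors n) (m 83 11))
         (trans (∑-minus (divisors n) (λ d → m 759 3 d - m 200 5 d) (m 642 7)) (cong (_- ∑ (divisors n) (m 642 7))
           (∑-minus (divisors n) (m 759 3) (m 200 5))))) ⟩
  ∑ (divisors n) (m 759 3) - ∑ (divisors n) (m 200 5) - ∑ (divisors n) (m 642 7) + ∑ (divisors n) (m 83 11)
    ≡⟨ cong₂ _+_ (cong₂ _-_ (cong₂ _-_ (pull 759 3) (pull 200 5)) (pull 642 7)) (pull 83 11) ⟩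
  (+ 759) * σ 3 n - (+ 200) * σ 5 n - (+ 642) * σ 7 n + (+ 83) * σ 11 n ∎
  where
  m : ℕ → ℕ → ℕ → ℤ
  m c r d = + c * (+ d) ^ r
  pull : ∀ c r → ∑ (divisors n) (m c r) ≡ + c * σ r n
  pull c r = ∑-*ˡ (divisors n) (+ c) (λ d → (+ d) ^ r)
  term : ∀ c k d → + c * ⟪ power 𝑏 k ⟫ 0ℤ (+ d) ≡ m c k d
  term c k d = cong (+ c *_) (⟪power-𝑏⟫ k 0ℤ (+ d))
  eval : ∀ c₁ c₂ c₃ c₄ e₁ e₂ e₃ e₄ a b → ⟪ Κ c₁ ⊗ e₁ ⊕ ⊝ (Κ c₂ ⊗ e₂) ⊕ ⊝ (Κ c₃ ⊗ e₃) ⊕ Κ c₄ ⊗ e₄ ⟫ a b ≡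
    c₁ * ⟪ e₁ ⟫ a b - c₂ * ⟪ e₂ ⟫ a b - c₃ * ⟪ e₃ ⟫ a b + c₄ * ⟪ e₄ ⟫ a b
  eval c₁ c₂ c₃ c₄ e₁ e₂ e₃ e₄ a b = refl
  pointwise : ∀ d → ⟪ P ⟫ 0ℤ (+ d) ≡ m 759 3 d - m 200 5 d - m 642 7 d + m 83 11 d
  pointwise d = trans
    (eval (+ 759) (+ 200) (+ 642) (+ 83) (power 𝑏 3) (power 𝑏 5) (power 𝑏 7) (power 𝑏 11) 0ℤ (+ d))
    (cong₂ _+_ (cong₂ _-_ (cong₂ _-_ (term 759 3 d) (term 200 5 d)) (term 642 7 d)) (term 83 11 d))

corollary1p11 : ∀ (n : ℕ) → .{{_ : NonZero n}} → 2 ∤ n →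
    (+ 2160) * (∑[ m ∈ 1⋯ (n ∸ 1) ] (σ† 3 m * σ† 7 (n ∸ m) - σ† 5 m * σ† 5 (n ∸ m)))
    + (+ 186480) * (∑[ m ∈ 1⋯ (n ∸ 1) ] (σ 3 m * σ 7 (n ∸ m) - σ 5 m * σ 5 (n ∸ m)))
    ≡ (+ 759) * σ 3 n - (+ 200) * σ 5 n - (+ 642) * σ 7 n + (+ 83) * σ 11 n
corollary1p11 n 2∤n = trans (sym (L-σ n)) (trans (*-cancelˡ-≡ (+ 2) _ _ (begin
  -- The factor 2 from symmetrizing `t` cancels against the factor 2 from the two mirror-image
  -- boundary cases.
  + 2 * (+ 90 * L n t)                          ≡⟨ *-leftComm (+ 2) (+ 90) (L n t) ⟩
  + 90 * (+ 2 * L n t)                          ≡⟨ cong (+ 90 *_) (L-summand n odd) ⟨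
  + 90 * L n (weight T)                         ≡⟨ L-T-divisors n (ℕ.>-nonZero⁻¹ n) odd ⟩
  + 2 * (∑[ d ∈ divisors n ] ⟪ P ⟫ 0ℤ (+ d))    ∎)) (∑-P n))
  where
  odd : parity n ≡ 1ℙ
  odd = parity-odd 2∤n
  t : Weight
  t = weight (λ p q r s → summand p q)
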